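{- Let $\mathcal{C},\mathcal{D}$ be coverings of $\mathbb{R}^2$ by complete folding curves which both satisfy the local isomorphism property. Then $\mathcal{C}$ and $\mathcal{D}$ are locally isomorphic if and only if, for each curve $C\in\mathcal{C}$ and each curve $D\in\mathcal{D}$, $C$ and $D$ have the same type and their associated sequences are locally isomorphic.
   Context: All sequences take values in $\{+1,-1\}$. For $S=(a_1,\dots,a_n)$ write $\overline{S}=(-a_n,\dots,-a_1)$. The $n$-folding sequences are defined recursively: the only $0$-folding sequence is the empty sequence, and the $(n+1)$-folding sequences are exactly $(\overline{S},+1,S)$ and $(\overline{S},-1,S)$ with $S$ an $n$-folding sequence. A subword of a sequence $(b_k)$ is a block $(b_{h+1},\dots,b_{h+m})$. A complete folding sequence is a sequence $(a_k)_{k\in\mathbb{Z}}$ each finite subword of which is a subword of some $n$-folding sequence. Two sequences indexed by $\mathbb{Z}$ are locally isomorphic if they have the same finite subwords. For a complete folding sequence $S=(a_h)$ there is $h_1\in\mathbb{Z}$ with $a_{h_1+4k}=(-1)^k a_{h_1}$ for all $k$; the set $E_1(S)=h_1+2\mathbb{Z}$ does not depend on the choice of $h_1$. A segment is an oriented unit edge of $\mathbb{Z}^2$. A complete curve is a sequence $C=(C_i)_{i\in\mathbb{Z}}$ of segments such that the terminal point of $C_i$ is the initial point of $C_{i+1}$, consecutive supports are perpendicular, and all supports are pairwise distinct (curves differing by an index shift are identified). Its associated sequence is $(\eta_i)_{i\in\mathbb{Z}}$ with $\eta_i=+1$ (resp. $-1$) if one turns left (resp. right) from $C_i$ to $C_{i+1}$.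 A complete folding curve is a complete curve whose associated sequence $S$ is a complete folding sequence; it has type $H$ (resp. $V$) if all the segments $C_i$ with $i\in E_1(S)$ have horizontal (resp. vertical) supports (one of the two always holds). A covering of $\mathbb{R}^2$ by complete folding curves is a set $\mathcal{C}$ of complete folding curves such that every unit edge of the lattice $\mathbb{Z}^2$ is the support of exactly one segment of exactly one curve of $\mathcal{C}$. A decorated segment of $\mathcal{C}$ is a segment of a curve of $\mathcal{C}$ together with, at each of its endpoints, the support of the segment of the same curve which precedes/follows it there. $\mathcal{C}$ satisfies the local isomorphism property if for every finite set $F$ of decorated segments of $\mathcal{C}$ there is $r>0$ such that every disk of radius $r$ contains a translate $v+F$ ($v\in\mathbb{Z}^2$) which is a set of decorated segments of $\mathcal{C}$. Two coverings are locally isomorphic if every finite set of decorated segments of either one is a translate of a set of decorated segments of the other. -}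

module Defs where

open import Data.Nat using (ℕ; zero; suc)
open import Data.Integer using (ℤ; +_; -[1+_]; _+_; _-_; _*_; _≤_; _<_) renaming (suc to sucℤ)
open import Data.Integer.Divisibility using (_∣_)
open import Data.List using (List; []; _∷_; _++_; map; reverse)
open import Data.List.Relation.Unary.All using (All)
open import Data.Product using (Σ; ∃; ∃-syntax; _×_; _,_)
open import Data.Sum using (_⊎_)
open import Relation.Binary.PropositionalEquality using (_≡_)
open import Function.Bundles using (_⇔_)

data Sign : Set where
  plus minus : Sign

neg : Sign → Sign
neg plus  = minus
neg minus = plus

bar : List Sign → List Sign
bar S = reverse (map neg S)

data Folding : ℕ → List Sign → Set where
  fold0 : Folding 0 []
  foldS : ∀ {n S} → Folding n S → (e : Sign) → Folding (suc n) (bar S ++ (e ∷ S))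

Subword : List Sign → List Sign → Set
Subword u v = ∃[ xs ] ∃[ ys ] (v ≡ xs ++ (u ++ ys))

Seq : Set
Seq = ℤ → Sign

word : Seq → ℤ → ℕ → List Sign
word a h zero    = []
word a h (suc m) = a (h + + 1) ∷ word a (h + + 1) m

CompleteFoldingSeq : Seq → Set
CompleteFoldingSeq a = ∀ (h : ℤ) (m : ℕ) → ∃[ n ] ∃[ S ] (Folding n S × Subword (word a h m) S)

LocIsoSeq : Seq → Seq → Set
LocIsoSeq a b =
  (∀ (h : ℤ) (m : ℕ) → ∃[ h' ] (word a h m ≡ word b h' m)) ×
  (∀ (h : ℤ) (m : ℕ) → ∃[ h' ] (word b h m ≡ word a h' m))

flipN : ℕ → Sign → Sign
flipN zero    s = s
flipN (suc n) s = neg (flipN n s)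

signPow : ℤ → Sign → Sign
signPow (+ n)      = flipN n
signPow -[1+ n ]   = flipN (suc n)

InE1 : Seq → ℤ → Set
InE1 a i = ∃[ h₁ ] ((∀ (k : ℤ) → a (h₁ + (+ 4) * k) ≡ signPow k (a h₁)) × ((+ 2) ∣ (i - h₁)))

Point : Set
Point = ℤ × ℤ

_⊕_ : Point → Point → Point
(a , b) ⊕ (c , d) = (a + c , b + d)

data Dir : Set where
  E N W S : Dir

data Orient : Set where
  hor ver : Orient

orient : Dir → Orient
orient E = hor
orient W = hor
orient N = ver
orient S = ver

step : Dir → Point
step E = (+ 1 , + 0)
step W = (-[1+ 0 ] , + 0)
step N = (+ 0 , + 1)
step S = (+ 0 , -[1+ 0 ])

record Segment : Set where
  constructor seg
  field
    start : Point
    dir   : Dir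
open Segment public

finish : Segment → Point
finish s = start s ⊕ step (dir s)

-- unoriented unit edge of ℤ²: its lower/left endpoint and orientation
record Edge : Set where
  constructor edge
  field
    base : Point
    ori  : Orient
open Edge public

support : Segment → Edge
support (seg p E) = edge p hor
support (seg p N) = edge p ver
support (seg p W) = edge (p ⊕ step W) hor
support (seg p S) = edge (p ⊕ step S) ver

Horizontal : Segment → Set
Horizontal s = orient (dir s) ≡ hor

Vertical : Segment → Set
Vertical s = orient (dir s) ≡ ver

turn : Dir → Dir → Sign
turn E N = plus
turn N W = plus
turn W S = plus
turn S E = plus
turn _ _ = minus

Curve : Set
Curve = ℤ → Segment

record IsCompleteCurve (C : Curve) : Set where
  field
    connected     : ∀ i → finish (C i) ≡ start (C (i + + 1))
    perpendicular : ∀ i → (orient (dir (C i)) ≡ hor × orient (dir (C (i + + 1))) ≡ ver)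
                        ⊎ (orient (dir (C i)) ≡ ver × orient (dir (C (i + + 1))) ≡ hor)
    distinct      : ∀ i j → support (C i) ≡ support (C j) → i ≡ j

assocSeq : Curve → Seq
assocSeq C i = turn (dir (C i)) (dir (C (i + + 1)))

TypeH : Curve → Set
TypeH C = ∀ i → InE1 (assocSeq C) i → Horizontal (C i)

TypeV : Curve → Set
TypeV C = ∀ i → InE1 (assocSeq C) i → Vertical (C i)

SameType : Curve → Curve → Set
SameType C D = (TypeH C × TypeH D) ⊎ (TypeV C × TypeV D)

-- Coverings of ℝ² by complete folding curves
-- (a set of curves, given as an indexed family; curves differing by a
-- shift are identified, which the uniqueness clause enforces)

record Covering : Set₁ where
  field
    Index    : Set
    curve    : Index → Curve
    complete : ∀ i → IsCompleteCurve (curve i)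
    folding  : ∀ i → CompleteFoldingSeq (assocSeq (curve i))
    covers   : ∀ (e : Edge) → ∃[ i ] ∃[ k ] (support (curve i k) ≡ e ×
                 (∀ i' k' → support (curve i' k') ≡ e → Σ (i' ≡ i) (λ _ → k' ≡ k)))
open Covering public

record Deco : Set where
  constructor deco
  field
    prevE : Edge
    dseg  : Segment
    nextE : Edge
open Deco public

decoAt : Curve → ℤ → Deco
decoAt C k = deco (support (C (k - + 1))) (C k) (support (C (k + + 1)))

IsDecoOf : Covering → Deco → Set
IsDecoOf 𝒞 d = ∃[ i ] ∃[ k ] (d ≡ decoAt (curve 𝒞 i) k)

translE : Point → Edge → Edge
translE v (edge p o) = edge (v ⊕ p) o

translS : Point → Segment → Segment
translS v (seg p d) = seg (v ⊕ p) d

transl : Point → Deco → Deco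
transl v (deco a s b) = deco (translE v a) (translS v s) (translE v b)

sq : ℤ → ℤ
sq x = x * x

InDiskP : Point → ℕ → Point → Set
InDiskP (cx , cy) r (px , py) = sq (px - cx) + sq (py - cy) ≤ (+ r) * (+ r)

InDisk : Point → ℕ → Deco → Set
InDisk c r d = InDiskP c r (start (dseg d)) × InDiskP c r (finish (dseg d))

LocalIsoProperty : Covering → Set
LocalIsoProperty 𝒞 =
  ∀ (F : List Deco) → All (IsDecoOf 𝒞) F →
  ∃[ r ] ((+ 0 < + r) × (∀ (c : Point) → ∃[ v ] All (λ d → IsDecoOf 𝒞 (transl v d) × InDisk c r (transl v d)) F))

LocIsoInto : Covering → Covering → Set
LocIsoInto 𝒞 𝒟 = ∀ (F : List Deco) → All (IsDecoOf 𝒞) F → ∃[ v ] All (λ d → IsDecoOf 𝒟 (transl v d)) F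

LocIsoCov : Covering → Covering → Set
LocIsoCov 𝒞 𝒟 = LocIsoInto 𝒞 𝒟 × LocIsoInto 𝒟 𝒞

{-# OPTIONS --safe #-}

-- In a complete folding sequence every second turn alternates in sign and the remaining
-- turns form a complete folding sequence again.  Joining the two edges at each alternating
-- turn therefore gives a folding curve on the lattice (1 + i)ℤ[i], and conversely the curve
-- is a refinement of that coarser one.  If all four edges at a lattice point are covered,
-- they stay covered under refinement, and the centre of a square with two opposite such
-- corners becomes covered in the same way.  Five refinements of one edge always produce two
-- adjacent points of this kind, so every complete folding curve contains arbitrarily large
-- full blocks.  Hence, in a covering with the local isomorphism property, every finite
-- pattern occurs inside each single curve, and comparing coverings reduces to comparing
-- two curves, whose patterns are determined up to translation by their turns, their type,
-- and a half turn; the half turn is harmless because every stretch of a folding curve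
-- recurs with all directions reversed.
module Submission where

open import Defs
open import Data.Bool using (Bool; true; false; _∧_; _∨_; T)
open import Data.Bool.ListAction using (any)
import Data.Bool.Properties as Boolₚ
open import Data.Empty using (⊥; ⊥-elim)
open import Data.Integer as ℤ using (ℤ; +_; -[1+_]; -_; _+_; _-_; _*_; ∣_∣)
import Data.Integer.Divisibility.Signed as Signed
import Data.Integer.Properties as ℤₚ
open import Data.Integer.Tactic.RingSolver using (solve-∀)
open import Data.List using (List; []; _∷_; _++_; [_]; map; length; upTo; applyUpTo)
import Data.List.Properties as Listₚ
open import Data.List.Relation.Unary.All as All using (All; []; _∷_)
import Data.List.Relation.Unary.All.Properties as Allₚ
import Data.List.Relation.Unary.Any as Any
import Data.List.Relation.Unary.Any.Properties as Anyₚ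
open import Data.Nat as ℕ using (ℕ; zero; suc; z≤n; s≤s)
import Data.Nat.Properties as ℕₚ
open import Data.Product using (Σ; ∃-syntax; _×_; _,_; proj₁; proj₂)
open import Data.Sum using (_⊎_; inj₁; inj₂; [_,_]′)
import Data.Sum as Sum
open import Data.Unit using (tt)
open import Data.Vec using (Vec; []; _∷_)
open import Function using (_∘_)
open import Function.Bundles using (_⇔_; mk⇔; module Equivalence)
open import Relation.Binary.PropositionalEquality hiding ([_])
open import Relation.Nullary using (¬_)

-- An alternating sign belongs to a moment of the walk, whereas a covering knows only edges. Since
-- the sign and the checkerboard colour of the vertex both change at each coarse step, the sign is a
-- function of the vertex, and refinement becomes a rule on unoriented edges. Once the starting edge
-- is moved to the origin, this rule depends on one unknown colour per refinement. Five refinements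
-- leave 4 directions and 32 colour patterns, so the first full vertices are found by evaluation
-- instead of geometry. Growth is measured over two refinements, because (1 + i)² = 2i takes
-- axis-parallel squares to axis-parallel squares of twice the side. With the vertex and centre
-- rules alone an adjacent pair would only grow into a longer segment; hence the detour through a
-- third corner of a square. Equal turns leave four possible rotations between two stretches of
-- curves, and equal types leave two of them; this is where the half turn comes from.

-- Signs, induction on integers, parity and doubling

neg-involutive : ∀ s → neg (neg s) ≡ s
neg-involutive plus  = refl
neg-involutive minus = refl

neg-irrefl : ∀ s → ¬ (s ≡ neg s)
neg-irrefl plus ()
neg-irrefl minus ()

flipN-neg : ∀ n s → flipN n (neg s) ≡ neg (flipN n s)
flipN-neg zero    s = refl
flipN-neg (suc n) s = cong neg (flipN-neg n s)

flipN-involutive : ∀ n s → flipN n (flipN n s) ≡ s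
flipN-involutive zero    s = refl
flipN-involutive (suc n) s =
  trans (cong neg (flipN-neg n (flipN n s)))
        (trans (neg-involutive _) (flipN-involutive n s))

signPow-suc : ∀ k s → signPow (k + + 1) s ≡ neg (signPow k s)
signPow-suc (+ n) s rewrite ℕₚ.+-comm n 1 = refl
signPow-suc -[1+ zero ]  s = sym (neg-involutive s)
signPow-suc -[1+ suc n ] s = sym (neg-involutive _)

ℤ-induction : ∀ {ℓ} (P : ℤ → Set ℓ) → P (+ 0) →
  (∀ k → P k → P (k + + 1)) → (∀ k → P (k + + 1) → P k) → ∀ k → P k
ℤ-induction P p₀ up down (+ zero) = p₀
ℤ-induction P p₀ up down (+ suc n) =
  subst P (cong +_ (ℕₚ.+-comm n 1)) (up (+ n) (ℤ-induction P p₀ up down (+ n)))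
ℤ-induction P p₀ up down -[1+ zero ] = down -[1+ 0 ] p₀
ℤ-induction P p₀ up down -[1+ suc n ] =
  down -[1+ suc n ] (ℤ-induction P p₀ up down -[1+ n ])

parity : ∀ x → ∃[ k ] ((x ≡ + 2 * k) ⊎ (x ≡ + 2 * k + + 1))
parity = ℤ-induction _ (+ 0 , inj₁ refl) up down
  where
  up₁ : ∀ k → + 2 * k + + 1 + + 1 ≡ + 2 * (k + + 1)
  up₁ = solve-∀
  down₁ : ∀ x → x + + 1 - + 1 ≡ x
  down₁ = solve-∀
  down₂ : ∀ k → + 2 * k - + 1 ≡ + 2 * (k - + 1) + + 1
  down₂ = solve-∀
  down₃ : ∀ k → + 2 * k + + 1 - + 1 ≡ + 2 * k
  down₃ = solve-∀
  up : ∀ x → ∃[ k ] ((x ≡ + 2 * k) ⊎ (x ≡ + 2 * k + + 1)) →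
       ∃[ k ] ((x + + 1 ≡ + 2 * k) ⊎ (x + + 1 ≡ + 2 * k + + 1))
  up x (k , inj₁ e) = k , inj₂ (cong (_+ + 1) e)
  up x (k , inj₂ e) = k + + 1 , inj₁ (trans (cong (_+ + 1) e) (up₁ k))
  down : ∀ x → ∃[ k ] ((x + + 1 ≡ + 2 * k) ⊎ (x + + 1 ≡ + 2 * k + + 1)) →
         ∃[ k ] ((x ≡ + 2 * k) ⊎ (x ≡ + 2 * k + + 1))
  down x (k , inj₁ e) = k - + 1 , inj₂ (trans (sym (down₁ x)) (trans (cong (_- + 1) e) (down₂ k)))
  down x (k , inj₂ e) = k , inj₁ (trans (sym (down₁ x)) (trans (cong (_- + 1) e) (down₃ k)))

parity-from : ∀ h x → ∃[ k ] ((x ≡ h + + 2 * k) ⊎ (x ≡ h + + 2 * k + + 1))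
parity-from h x =
  let k , p = parity (x - h)
  in k , Sum.map (λ e → trans (lem x h) (cong (λ z → h + z) e))
                 (λ e → trans (lem x h) (trans (cong (λ z → h + z) e) (sym (ℤₚ.+-assoc h (+ 2 * k) (+ 1))))) p
  where
  lem : ∀ x h → x ≡ h + (x - h)
  lem = solve-∀

double : ℕ → ℕ
double zero    = zero
double (suc n) = suc (suc (double n))

+double : ∀ n → + double n ≡ + 2 * + n
+double zero    = refl
+double (suc n) = trans (cong (λ z → + 2 + z) (+double n)) (lem (+ n))
  where
  lem : ∀ x → + 2 + + 2 * x ≡ + 2 * (+ 1 + x)
  lem = solve-∀

double-+ : ∀ m n → double (m ℕ.+ n) ≡ double m ℕ.+ double n
double-+ zero    n = refl
double-+ (suc m) n = cong (suc ∘ suc) (double-+ m n)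

-- The slack of one on the right absorbs the odd length `suc (double n)` of an interleaving.
double-cancel-≤ : ∀ m n → double m ℕ.≤ suc (double n) → m ℕ.≤ n
double-cancel-≤ zero    n p = z≤n
double-cancel-≤ (suc m) zero (s≤s ())
double-cancel-≤ (suc m) (suc n) (s≤s (s≤s p)) = s≤s (double-cancel-≤ m n p)

double-mono-≤ : ∀ {m n} → m ℕ.≤ n → double m ℕ.≤ double n
double-mono-≤ z≤n     = z≤n
double-mono-≤ (s≤s p) = s≤s (s≤s (double-mono-≤ p))

n≤double : ∀ n → n ℕ.≤ double n
n≤double zero    = z≤n
n≤double (suc n) = s≤s (ℕₚ.m≤n⇒m≤1+n (n≤double n))

double≡2* : ∀ n → double n ≡ 2 ℕ.* n
double≡2* n = ℤₚ.+-injective (trans (+double n) (sym (ℤₚ.pos-* 2 n)))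

n<2^n : ∀ n → n ℕ.< 2 ℕ.^ n
n<2^n zero    = s≤s z≤n
n<2^n (suc n) = subst (suc n ℕ.<_) (double≡2* (2 ℕ.^ n)) (grow (2 ℕ.^ n) (n<2^n n))
  where
  grow : ∀ m → suc n ℕ.≤ m → suc (suc n) ℕ.≤ double m
  grow (suc m) (s≤s p) = s≤s (s≤s (ℕₚ.≤-trans p (n≤double m)))

ℕ-parity : ∀ n → ∃[ k ] ((n ≡ double k) ⊎ (n ≡ suc (double k)))
ℕ-parity zero = 0 , inj₁ refl
ℕ-parity (suc n) with ℕ-parity n
... | k , inj₁ e = k , inj₂ (cong suc e)
... | k , inj₂ e = suc k , inj₁ (cong suc e)

-- Folding words as interleavings

-- Out-of-range positions read as plus.
at : List Sign → ℕ → Sign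
at []       _       = plus
at (x ∷ xs) zero    = x
at (x ∷ xs) (suc i) = at xs i

at-++ˡ : ∀ xs ys {j} → j ℕ.< length xs → at (xs ++ ys) j ≡ at xs j
at-++ˡ (x ∷ xs) ys {zero}  _       = refl
at-++ˡ (x ∷ xs) ys {suc j} (s≤s p) = at-++ˡ xs ys p

at-++ʳ : ∀ xs ys j → at (xs ++ ys) (length xs ℕ.+ j) ≡ at ys j
at-++ʳ []       ys j = refl
at-++ʳ (x ∷ xs) ys j = at-++ʳ xs ys j

-- The Toeplitz form of paperfolding words: the creases of the last fold alternate and enclose the
-- earlier ones. It complements the mirror recursion of `Folding`.
interleave : Sign → List Sign → List Sign
interleave s []      = [ s ]
interleave s (t ∷ T) = s ∷ t ∷ interleave (neg s) T

interleave-++ : ∀ s U t T →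
  interleave s (U ++ t ∷ T) ≡ interleave s U ++ t ∷ interleave (neg (flipN (length U) s)) T
interleave-++ s []      t T = refl
interleave-++ s (u ∷ U) t T = cong (λ z → s ∷ u ∷ z)
  (trans (interleave-++ (neg s) U t T)
         (cong (λ z → interleave (neg s) U ++ t ∷ interleave (neg z) T) (flipN-neg (length U) s)))

bar-∷ : ∀ s T → bar (s ∷ T) ≡ bar T ++ [ neg s ]
bar-∷ s T = Listₚ.unfold-reverse (neg s) (map neg T)

length-bar : ∀ T → length (bar T) ≡ length T
length-bar T = trans (Listₚ.length-reverse (map neg T)) (Listₚ.length-map neg T)

-- The alternating part ends with `flipN (length T) s`, so after reversal and negation it begins
-- with the opposite of that sign and alternates again.
bar-interleave : ∀ s T → bar (interleave s T) ≡ interleave (neg (flipN (length T) s)) (bar T)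
bar-interleave s []      = refl
bar-interleave s (t ∷ T) = begin
  bar (s ∷ t ∷ interleave (neg s) T)
    ≡⟨ bar-∷ s (t ∷ interleave (neg s) T) ⟩
  bar (t ∷ interleave (neg s) T) ++ [ neg s ]
    ≡⟨ cong (_++ [ neg s ]) (bar-∷ t (interleave (neg s) T)) ⟩
  (bar (interleave (neg s) T) ++ [ neg t ]) ++ [ neg s ]
    ≡⟨ Listₚ.++-assoc (bar (interleave (neg s) T)) [ neg t ] [ neg s ] ⟩
  bar (interleave (neg s) T) ++ neg t ∷ neg s ∷ []
    ≡⟨ cong (_++ neg t ∷ neg s ∷ []) (bar-interleave (neg s) T) ⟩
  interleave (neg (flipN ℓ (neg s))) (bar T) ++ neg t ∷ neg s ∷ []
    ≡⟨ cong (λ z → interleave (neg z) (bar T) ++ neg t ∷ neg s ∷ []) (flipN-neg ℓ s) ⟩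
  interleave s′ (bar T) ++ neg t ∷ neg s ∷ []
    ≡⟨ cong (λ z → interleave s′ (bar T) ++ neg t ∷ z ∷ []) last ⟩
  interleave s′ (bar T) ++ neg t ∷ neg (flipN (length (bar T)) s′) ∷ []
    ≡⟨ interleave-++ s′ (bar T) (neg t) [] ⟨
  interleave s′ (bar T ++ [ neg t ])
    ≡⟨ cong (interleave s′) (bar-∷ t T) ⟨
  interleave s′ (bar (t ∷ T)) ∎
  where
  open ≡-Reasoning
  ℓ  = length T
  s′ = neg (neg (flipN ℓ s))
  last : neg s ≡ neg (flipN (length (bar T)) s′)
  last rewrite length-bar T | neg-involutive (flipN ℓ s) | flipN-involutive ℓ s = refl

-- If `S` begins with `s`, then `bar S` ends with `neg s`, so the alternation continues across the
-- middle sign `e`. As `bar S` has odd length, `e` falls among the entries of the shorter folding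
-- word.
folding-interleave : ∀ {n F} → Folding (suc n) F →
  ∃[ s ] ∃[ T ] (Folding n T × F ≡ interleave s T)
folding-interleave {zero} (foldS fold0 e) = e , [] , fold0 , refl
folding-interleave {suc n} (foldS f e) with folding-interleave f
... | s , T , fT , refl = s′ , bar T ++ e ∷ T , foldS fT e , eq
  where
  s′ = neg (flipN (length T) s)
  back : s ≡ neg (flipN (length (bar T)) s′)
  back rewrite length-bar T | flipN-neg (length T) (flipN (length T) s)
             | flipN-involutive (length T) s = sym (neg-involutive s)
  eq : bar (interleave s T) ++ e ∷ interleave s T ≡ interleave s′ (bar T ++ e ∷ T)
  eq = trans (cong₂ (λ x y → x ++ e ∷ interleave y T) (bar-interleave s T) back)
             (sym (interleave-++ s′ (bar T) e T))

length-interleave : ∀ s T → length (interleave s T) ≡ suc (double (length T))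
length-interleave s []      = refl
length-interleave s (t ∷ T) = cong (suc ∘ suc) (length-interleave (neg s) T)

at-interleave-even : ∀ s T i → i ℕ.≤ length T → at (interleave s T) (double i) ≡ flipN i s
at-interleave-even s []      zero    p = refl
at-interleave-even s (t ∷ T) zero    p = refl
at-interleave-even s (t ∷ T) (suc i) (s≤s p) =
  trans (at-interleave-even (neg s) T i p) (flipN-neg i s)

at-interleave-odd : ∀ s T i → i ℕ.< length T → at (interleave s T) (suc (double i)) ≡ at T i
at-interleave-odd s (t ∷ T) zero    p       = refl
at-interleave-odd s (t ∷ T) (suc i) (s≤s p) = at-interleave-odd (neg s) T i p

-- Complete folding sequences and their derivations

-- Subword occurrences in index form; the parity of the offset `o` will decide the phase of the
-- alternating places.
FoldingWindow : Seq → ℤ → ℕ → Set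
FoldingWindow a x m = ∃[ n ] ∃[ F ] ∃[ o ] (Folding n F × o ℕ.+ m ℕ.≤ length F ×
  (∀ j → j ℕ.< m → a (x + + j) ≡ at F (o ℕ.+ j)))

length-word : ∀ a h m → length (word a h m) ≡ m
length-word a h zero    = refl
length-word a h (suc m) = cong suc (length-word a (h + + 1) m)

at-word : ∀ a h m {j} → j ℕ.< m → at (word a h m) j ≡ a (h + + 1 + + j)
at-word a h (suc m) {zero}  _       = cong a (sym (ℤₚ.+-identityʳ _))
at-word a h (suc m) {suc j} (s≤s p) =
  trans (at-word a (h + + 1) m p) (cong a (ℤₚ.+-assoc (h + + 1) (+ 1) (+ j)))

word-window : ∀ {a} → CompleteFoldingSeq a → ∀ x m → FoldingWindow a x m
-- `word a h m` starts at `h + 1`, hence the shift by one.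
word-window {a} cf x m with cf (x - + 1) m
... | n , F , f , xs , ys , refl = n , F , length xs , f , bound , agree
  where
  u = word a (x - + 1) m
  back : ∀ x → x - + 1 + + 1 ≡ x
  back = solve-∀
  bound : length xs ℕ.+ m ℕ.≤ length (xs ++ (u ++ ys))
  bound rewrite Listₚ.length-++ xs {u ++ ys} | Listₚ.length-++ u {ys} | length-word a (x - + 1) m =
    ℕₚ.+-monoʳ-≤ (length xs) (ℕₚ.m≤m+n m (length ys))
  agree : ∀ j → j ℕ.< m → a (x + + j) ≡ at (xs ++ (u ++ ys)) (length xs ℕ.+ j)
  agree j p = sym (begin
    at (xs ++ (u ++ ys)) (length xs ℕ.+ j) ≡⟨ at-++ʳ xs (u ++ ys) j ⟩
    at (u ++ ys) j ≡⟨ at-++ˡ u ys (subst (j ℕ.<_) (sym (length-word a (x - + 1) m)) p) ⟩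
    at u j ≡⟨ at-word a (x - + 1) m p ⟩
    a (x - + 1 + + 1 + + j) ≡⟨ cong (λ z → a (z + + j)) (back x) ⟩
    a (x + + j) ∎)
    where open ≡-Reasoning

word-prefix : ∀ a h m F → m ℕ.≤ length F → (∀ j → j ℕ.< m → a (h + + 1 + + j) ≡ at F j) →
  ∃[ ys ] (F ≡ word a h m ++ ys)
word-prefix a h zero    F       _       _     = F , refl
word-prefix a h (suc m) (s ∷ F) (s≤s p) agree
  with word-prefix a (h + + 1) m F p
         (λ j q → trans (cong a (ℤₚ.+-assoc (h + + 1) (+ 1) (+ j))) (agree (suc j) (s≤s q)))
... | ys , e = ys , cong₂ _∷_ (trans (sym (agree 0 (s≤s z≤n))) (cong a (ℤₚ.+-identityʳ _))) e

word-subword : ∀ a h m o F → o ℕ.+ m ℕ.≤ length F →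
  (∀ j → j ℕ.< m → a (h + + 1 + + j) ≡ at F (o ℕ.+ j)) → Subword (word a h m) F
word-subword a h m zero    F       p agree with word-prefix a h m F p agree
... | ys , e = [] , ys , e
word-subword a h m (suc o) (s ∷ F) (s≤s p) agree with word-subword a h m o F p agree
... | xs , ys , e = s ∷ xs , ys , cong (s ∷_) e

window-word : ∀ a h m → FoldingWindow a (h + + 1) m →
  ∃[ n ] ∃[ F ] (Folding n F × Subword (word a h m) F)
window-word a h m (n , F , o , f , p , agree) = n , F , f , word-subword a h m o F p agree

window-sub : ∀ a x m i m′ → i ℕ.+ m′ ℕ.≤ m → FoldingWindow a x m → FoldingWindow a (x + + i) m′
window-sub a x m i m′ le (n , F , o , f , p , agree) = n , F , o ℕ.+ i , f , bound , agree′
  where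
  bound : o ℕ.+ i ℕ.+ m′ ℕ.≤ length F
  bound = subst (ℕ._≤ length F) (sym (ℕₚ.+-assoc o i m′)) (ℕₚ.≤-trans (ℕₚ.+-monoʳ-≤ o le) p)
  agree′ : ∀ j → j ℕ.< m′ → a (x + + i + + j) ≡ at F (o ℕ.+ i ℕ.+ j)
  agree′ j q = trans (cong a (ℤₚ.+-assoc x (+ i) (+ j)))
    (trans (agree (i ℕ.+ j) (ℕₚ.<-≤-trans (ℕₚ.+-monoʳ-< i q) le)) (cong (at F) (sym (ℕₚ.+-assoc o i j))))

record Splits (a : Seq) (x : ℤ) (L : ℕ) : Set where
  field
    alternates : ∀ i → i ℕ.< L → a (x + + 2 * + suc i) ≡ neg (a (x + + 2 * + i))
    rest       : FoldingWindow (λ k → a (x + + 2 * k + + 1)) (+ 0) L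
open Splits

-- An even offset puts the alternating part at `x`, an odd one at `x + 1`. In the second phase the
-- last sign read is at `x + 1 + 2 * L`, which is the last entry of a window of length
-- `double (suc L)`.
window-splits : ∀ a x L → FoldingWindow a x (double (suc L)) → Splits a x L ⊎ Splits a (x + + 1) L
window-splits a x L (zero , .[] , o , fold0 , p , _) = ⊥-elim (impossible o p)
  where
  impossible : ∀ o → ¬ (o ℕ.+ double (suc L) ℕ.≤ 0)
  impossible zero ()
  impossible (suc o) ()
window-splits a x L (suc n , F , o , f , p , agree) with folding-interleave f | ℕ-parity o
... | s , T , fT , refl | o′ , inj₁ refl = inj₁ record
  { alternates = λ i i<L → trans (even (suc i) i<L)
      (trans (cong (λ z → flipN z s) (ℕₚ.+-suc o′ i)) (cong neg (sym (even i (ℕₚ.<⇒≤ i<L)))))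
  ; rest = n , T , o′ , fT , ℕₚ.≤-trans (ℕₚ.+-monoʳ-≤ o′ (ℕₚ.n≤1+n L)) len , odd }
  where
  len : o′ ℕ.+ suc L ℕ.≤ length T
  len = double-cancel-≤ _ _ (subst₂ ℕ._≤_ (sym (double-+ o′ (suc L))) (length-interleave s T) p)
  le : ∀ {i} → i ℕ.≤ suc L → o′ ℕ.+ i ℕ.≤ length T
  le q = ℕₚ.≤-trans (ℕₚ.+-monoʳ-≤ o′ q) len
  even : ∀ i → i ℕ.≤ L → a (x + + 2 * + i) ≡ flipN (o′ ℕ.+ i) s
  even i q = trans (cong (λ z → a (x + z)) (sym (+double i)))
    (trans (agree (double i) (s≤s (ℕₚ.m≤n⇒m≤1+n (double-mono-≤ q))))
    (trans (cong (at (interleave s T)) (sym (double-+ o′ i)))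
           (at-interleave-even s T (o′ ℕ.+ i) (le (ℕₚ.m≤n⇒m≤1+n q)))))
  odd : ∀ j → j ℕ.< L → a (x + + 2 * (+ 0 + + j) + + 1) ≡ at T (o′ ℕ.+ j)
  odd j q = trans (cong a (trans (idx x (+ j)) (cong (λ z → x + (+ 1 + z)) (sym (+double j)))))
    (trans (agree (suc (double j)) (s≤s (s≤s (double-mono-≤ (ℕₚ.<⇒≤ q)))))
    (trans (cong (at (interleave s T)) (trans (ℕₚ.+-suc (double o′) (double j)) (cong suc (sym (double-+ o′ j)))))
           (at-interleave-odd s T (o′ ℕ.+ j)
             (subst (ℕ._≤ length T) (ℕₚ.+-suc o′ j) (le (ℕₚ.m≤n⇒m≤1+n q))))))
    where
    idx : ∀ x j → x + + 2 * (+ 0 + j) + + 1 ≡ x + (+ 1 + + 2 * j)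
    idx = solve-∀
... | s , T , fT , refl | o′ , inj₂ refl = inj₂ record
  { alternates = λ i i<L → trans (even (suc i) i<L)
      (trans (cong (λ z → flipN z s) (ℕₚ.+-suc (suc o′) i)) (cong neg (sym (even i (ℕₚ.<⇒≤ i<L)))))
  ; rest = n , T , suc o′ , fT , len , odd }
  where
  len : suc o′ ℕ.+ L ℕ.≤ length T
  len = double-cancel-≤ (suc o′ ℕ.+ L) _ (ℕₚ.≤-trans (ℕₚ.n≤1+n _)
    (subst₂ ℕ._≤_ (cong suc (trans (sym (double-+ o′ (suc L))) (cong double (ℕₚ.+-suc o′ L))))
                  (length-interleave s T) p))
  le : ∀ {i} → i ℕ.≤ L → suc o′ ℕ.+ i ℕ.≤ length T
  le q = ℕₚ.≤-trans (ℕₚ.+-monoʳ-≤ (suc o′) q) len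
  even : ∀ i → i ℕ.≤ L → a (x + + 1 + + 2 * + i) ≡ flipN (suc o′ ℕ.+ i) s
  even i q = trans (cong a (trans (ℤₚ.+-assoc x (+ 1) (+ 2 * + i)) (cong (λ z → x + (+ 1 + z)) (sym (+double i)))))
    (trans (agree (suc (double i)) (s≤s (s≤s (double-mono-≤ q))))
    (trans (cong (at (interleave s T)) (trans (cong suc (ℕₚ.+-suc (double o′) (double i))) (sym (double-+ (suc o′) i))))
           (at-interleave-even s T (suc o′ ℕ.+ i) (le q))))
  odd : ∀ j → j ℕ.< L → a (x + + 1 + + 2 * (+ 0 + + j) + + 1) ≡ at T (suc o′ ℕ.+ j)
  odd j q = trans (cong a (trans (idx x (+ j)) (cong (λ z → x + z) (sym (+double (suc j))))))
    (trans (agree (double (suc j)) (s≤s (s≤s (ℕₚ.≤-trans (ℕₚ.n≤1+n _) (double-mono-≤ q)))))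
    (trans (cong (λ z → at (interleave s T) (suc z))
             (trans (ℕₚ.+-suc (double o′) (suc (double j))) (cong suc (trans (ℕₚ.+-suc (double o′) (double j)) (cong suc (sym (double-+ o′ j)))))))
           (at-interleave-odd s T (suc o′ ℕ.+ j) (subst (ℕ._≤ length T) (ℕₚ.+-suc (suc o′) j) (le q)))))
    where
    idx : ∀ x j → x + + 1 + + 2 * (+ 0 + j) + + 1 ≡ x + + 2 * (+ 1 + j)
    idx = solve-∀

fromCentre : ∀ k r → ∣ k ∣ ℕ.≤ r → ∃[ n ] (k ≡ + n - + r × n ℕ.≤ ∣ k ∣ ℕ.+ r)
fromCentre (+ j) r p = j ℕ.+ r , lem (+ j) (+ r) , ℕₚ.≤-refl
  where
  lem : ∀ j r → j ≡ j + r - r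
  lem = solve-∀
fromCentre -[1+ j ] r p = r ℕ.∸ suc j ,
  trans (lem (+ suc j) (+ (r ℕ.∸ suc j)))
        (cong (λ z → + (r ℕ.∸ suc j) - + z) (trans (ℕₚ.+-comm (suc j) _) (ℕₚ.m∸n+n≡m p))) ,
  ℕₚ.≤-trans (ℕₚ.m∸n≤m r (suc j)) (ℕₚ.m≤n+m r (suc j))
  where
  lem : ∀ j n → - j ≡ n - (j + n)
  lem = solve-∀

-- The positions base + 2ℤ + 1 are the set E₁ of the sequence.
record Derivation (a : Seq) : Set where
  field
    base        : ℤ
    alternating : ∀ k → a (base + + 2 * (k + + 1)) ≡ neg (a (base + + 2 * k))
    derived     : CompleteFoldingSeq (λ k → a (base + + 2 * k + + 1))
open Derivation

neg-neg-cancel : ∀ {x y z : Sign} → z ≡ neg y → y ≡ neg x → z ≡ neg x → ⊥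
neg-neg-cancel {x} refl refl e = neg-irrefl x (trans (sym (neg-involutive x)) e)

-- Every second entry of a folding window flips when its index is increased by two.
not-alternating : ∀ b x → FoldingWindow b x 4 →
  (∀ i → i ℕ.< 3 → b (x + + suc i) ≡ neg (b (x + + i))) → ⊥
not-alternating b x w alt with window-splits b x 1 w
... | inj₁ s = neg-neg-cancel (alt 1 (s≤s (s≤s z≤n))) (alt 0 (s≤s z≤n)) (alternates s 0 (s≤s z≤n))
... | inj₂ s = neg-neg-cancel (alt 2 (s≤s (s≤s (s≤s z≤n)))) (alt 1 (s≤s (s≤s z≤n)))
  (subst₂ (λ y z → b y ≡ neg (b z)) (ℤₚ.+-assoc x (+ 1) (+ 2)) (ℤₚ.+-assoc x (+ 1) (+ 0)) (alternates s 0 (s≤s z≤n)))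

-- Both phases cannot hold: the places that alternate in the second are the `rest` of the first,
-- which is a folding window and cannot alternate four times in a row.
splits-parity : ∀ {a} x r L → 3 ℕ.+ r ℕ.≤ L → Splits a x 4 → Splits a (x + + 1 - + 2 * + r) L → ⊥
splits-parity {a} x r L le s₁ s₂ = not-alternating (λ k → a (x + + 2 * k + + 1)) (+ 0) (rest s₁) alt
  where
  idx : ∀ x r i → x + + 2 * i + + 1 ≡ x + + 1 - + 2 * r + + 2 * (i + r)
  idx = solve-∀
  alt : ∀ i → i ℕ.< 3 → a (x + + 2 * + suc i + + 1) ≡ neg (a (x + + 2 * + i + + 1))
  alt i p = trans (cong a (idx x (+ r) (+ suc i)))
    (trans (alternates s₂ (i ℕ.+ r) (ℕₚ.<-≤-trans (ℕₚ.+-monoˡ-< r p) le))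
           (cong (neg ∘ a) (sym (idx x (+ r) (+ i)))))

-- The window for `r` begins `2 * r` before `b` and reaches at least as far beyond it, so these
-- windows exhaust ℤ. The extra 4 is slack for comparing phases in `derivation`.
derivation-from : ∀ {a} b → (∀ r → Splits a (b - + 2 * + r) (r ℕ.+ r ℕ.+ 4)) → Derivation a
derivation-from {a} b splits = record { base = b ; alternating = alt ; derived = der }
  where
  alt : ∀ k → a (b + + 2 * (k + + 1)) ≡ neg (a (b + + 2 * k))
  alt k with fromCentre k ∣ k ∣ ℕₚ.≤-refl
  ... | n , e , le = trans (cong a (trans (cong (λ z → b + + 2 * (z + + 1)) e) (idx₁ b (+ n) (+ r))))
      (trans (alternates (splits r) n (ℕₚ.≤-<-trans le (ℕₚ.m<m+n _ (s≤s z≤n))))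
             (cong (neg ∘ a) (sym (trans (cong (λ z → b + + 2 * z) e) (idx₂ b (+ n) (+ r))))))
    where
    r = ∣ k ∣
    idx₁ : ∀ b n r → b + + 2 * (n - r + + 1) ≡ b - + 2 * r + + 2 * (+ 1 + n)
    idx₁ = solve-∀
    idx₂ : ∀ b n r → b + + 2 * (n - r) ≡ b - + 2 * r + + 2 * n
    idx₂ = solve-∀
  der : CompleteFoldingSeq (λ k → a (b + + 2 * k + + 1))
  der h m with fromCentre h (∣ h ∣ ℕ.+ m) (ℕₚ.m≤m+n _ m)
  ... | n , e , le with window-sub (λ k → a (b - + 2 * + (∣ h ∣ ℕ.+ m) + + 2 * k + + 1)) (+ 0) _ (suc n) m bound (rest (splits r))
    where
    r = ∣ h ∣ ℕ.+ m
    bound : suc n ℕ.+ m ℕ.≤ r ℕ.+ r ℕ.+ 4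
    bound = begin
      suc n ℕ.+ m                       ≤⟨ s≤s (ℕₚ.+-monoˡ-≤ m le) ⟩
      suc (∣ h ∣ ℕ.+ r ℕ.+ m)           ≡⟨ cong suc (trans (ℕₚ.+-assoc ∣ h ∣ r m) (cong (∣ h ∣ ℕ.+_) (ℕₚ.+-comm r m))) ⟩
      suc (∣ h ∣ ℕ.+ (m ℕ.+ r))         ≡⟨ cong suc (ℕₚ.+-assoc ∣ h ∣ m r) ⟨
      suc (r ℕ.+ r)                     ≡⟨ ℕₚ.+-comm 1 (r ℕ.+ r) ⟩
      r ℕ.+ r ℕ.+ 1                     ≤⟨ ℕₚ.+-monoʳ-≤ (r ℕ.+ r) (s≤s z≤n) ⟩
      r ℕ.+ r ℕ.+ 4                     ∎
      where open ℕₚ.≤-Reasoning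
  ... | N′ , F , o , f , p , agree = window-word _ h m (N′ , F , o , f , p ,
      λ j q → trans (cong a (trans (cong (λ z → b + + 2 * (z + + 1 + + j) + + 1) e)
                                   (idx b (+ n) (+ (∣ h ∣ ℕ.+ m)) (+ j)))) (agree j q))
    where
    idx : ∀ b n r j → b + + 2 * (n - r + + 1 + j) + + 1 ≡ b - + 2 * r + + 2 * (+ 0 + (+ 1 + n) + j) + + 1
    idx = solve-∀

-- One window of length 10 fixes the phase, and `splits-parity` forces every larger window around it
-- to agree. Ten is `double 5`, enough for four entries of `rest`.
derivation : ∀ {a} → CompleteFoldingSeq a → Derivation a
derivation {a} cf with window-splits a (+ 0) 4 (word-window cf (+ 0) 10)
... | inj₁ s₀ = derivation-from (+ 0) splits
  where
  splits : ∀ r → Splits a (+ 0 - + 2 * + r) (r ℕ.+ r ℕ.+ 4)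
  splits r with window-splits a (+ 0 - + 2 * + r) (r ℕ.+ r ℕ.+ 4) (word-window cf (+ 0 - + 2 * + r) (double (suc (r ℕ.+ r ℕ.+ 4))))
  ... | inj₁ s = s
  ... | inj₂ s = ⊥-elim (splits-parity (+ 0) r (r ℕ.+ r ℕ.+ 4) le s₀ (subst (λ z → Splits a z (r ℕ.+ r ℕ.+ 4)) (idx (+ r)) s))
    where
    idx : ∀ r → + 0 - + 2 * r + + 1 ≡ + 0 + + 1 - + 2 * r
    idx = solve-∀
    le : 3 ℕ.+ r ℕ.≤ r ℕ.+ r ℕ.+ 4
    le = subst (ℕ._≤ r ℕ.+ r ℕ.+ 4) (ℕₚ.+-comm r 3) (ℕₚ.+-mono-≤ (ℕₚ.m≤m+n r r) (s≤s (s≤s (s≤s z≤n))))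
... | inj₂ s₀ = derivation-from (+ 1) splits
  where
  splits : ∀ r → Splits a (+ 1 - + 2 * + r) (r ℕ.+ r ℕ.+ 4)
  splits r with window-splits a (+ 0 - + 2 * + r) (r ℕ.+ r ℕ.+ 4) (word-window cf (+ 0 - + 2 * + r) (double (suc (r ℕ.+ r ℕ.+ 4))))
  ... | inj₂ s = subst (λ z → Splits a z (r ℕ.+ r ℕ.+ 4)) (idx (+ r)) s
    where
    idx : ∀ r → + 0 - + 2 * r + + 1 ≡ + 1 - + 2 * r
    idx = solve-∀
  -- Measured from `+ 0 + + 1 + + 1` the offset is `suc r` rather than `r`; at `r = 0` this uses up
  -- the whole slack of 4.
  ... | inj₁ s = ⊥-elim (splits-parity (+ 0 + + 1) (suc r) (r ℕ.+ r ℕ.+ 4) le s₀ (subst (λ z → Splits a z (r ℕ.+ r ℕ.+ 4)) (idx (+ r)) s))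
    where
    idx : ∀ r → + 0 - + 2 * r ≡ + 0 + + 1 + + 1 - + 2 * (+ 1 + r)
    idx = solve-∀
    le : 4 ℕ.+ r ℕ.≤ r ℕ.+ r ℕ.+ 4
    le = subst (ℕ._≤ r ℕ.+ r ℕ.+ 4) (ℕₚ.+-comm r 4) (ℕₚ.+-monoˡ-≤ 4 (ℕₚ.m≤m+n r r))

-- Powers of a sign and the set E₁

signPow-+ : ∀ k l s → signPow (k + l) s ≡ signPow k (signPow l s)
signPow-+ k l s = ℤ-induction (λ k → signPow (k + l) s ≡ signPow k (signPow l s))
  (cong (λ z → signPow z s) (ℤₚ.+-identityˡ l)) up down k
  where
  shift : ∀ k l → k + + 1 + l ≡ k + l + + 1
  shift = solve-∀
  unfold : ∀ k → signPow (k + + 1 + l) s ≡ neg (signPow (k + l) s)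
  unfold k = trans (cong (λ z → signPow z s) (shift k l)) (signPow-suc (k + l) s)
  up : ∀ k → signPow (k + l) s ≡ signPow k (signPow l s) →
       signPow (k + + 1 + l) s ≡ signPow (k + + 1) (signPow l s)
  up k e = trans (unfold k) (trans (cong neg e) (sym (signPow-suc k (signPow l s))))
  down : ∀ k → signPow (k + + 1 + l) s ≡ signPow (k + + 1) (signPow l s) →
         signPow (k + l) s ≡ signPow k (signPow l s)
  down k e = trans (sym (neg-involutive _)) (trans (cong neg
    (trans (sym (unfold k)) (trans e (signPow-suc k (signPow l s))))) (neg-involutive _))

signPow-involutive : ∀ k s → signPow k (signPow k s) ≡ s
signPow-involutive (+ n)    s = flipN-involutive n s
signPow-involutive -[1+ n ] s = flipN-involutive (suc n) s

signPow-even : ∀ k q s → signPow (k + + 2 * q) s ≡ signPow k s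
signPow-even k q s = trans (signPow-+ k (+ 2 * q) s) (cong (signPow k)
  (trans (cong (λ z → signPow z s) (twice q)) (trans (signPow-+ q q s) (signPow-involutive q s))))
  where
  twice : ∀ q → + 2 * q ≡ q + q
  twice = solve-∀

alternates⇒signPow : ∀ (f : ℤ → Sign) → (∀ k → f (k + + 1) ≡ neg (f k)) → ∀ k → f k ≡ signPow k (f (+ 0))
alternates⇒signPow f alt = ℤ-induction _ refl
  (λ k e → trans (alt k) (trans (cong neg e) (sym (signPow-suc k _))))
  (λ k e → trans (sym (neg-involutive _)) (trans (cong neg (trans (sym (alt k)) (trans e (signPow-suc k _)))) (neg-involutive _)))

Alternating₄ : Seq → ℤ → Set
Alternating₄ a y = ∀ i → i ℕ.< 3 → a (y + + 2 * + suc i) ≡ neg (a (y + + 2 * + i))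

2k≢2l+1 : ∀ h k l → h + + 2 * k ≡ h + + 2 * l + + 1 → ⊥
2k≢2l+1 h k l e = neg-irrefl plus (trans (sym even) odd)
  where
  diff : ∀ h k l → + 0 + + 2 * (k - l) ≡ (h + + 2 * k) - (h + + 2 * l)
  diff = solve-∀
  one : ∀ x → x + + 1 - x ≡ + 1
  one = solve-∀
  even : signPow (+ 0 + + 2 * (k - l)) plus ≡ plus
  even = signPow-even (+ 0) (k - l) plus
  odd : signPow (+ 0 + + 2 * (k - l)) plus ≡ minus
  odd = cong (λ z → signPow z plus) (trans (diff h k l) (trans (cong (_- (h + + 2 * l)) e) (one (h + + 2 * l))))

module _ {a : Seq} (D : Derivation a) where

  signs : ∀ k → a (base D + + 2 * k) ≡ signPow k (a (base D))
  signs k = trans (alternates⇒signPow (λ k → a (base D + + 2 * k)) (alternating D) k)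
                  (cong (signPow k ∘ a) (ℤₚ.+-identityʳ (base D)))

  signs-even : ∀ k q → a (base D + + 2 * (k + + 2 * q)) ≡ a (base D + + 2 * k)
  signs-even k q = trans (signs (k + + 2 * q)) (trans (signPow-even k q _) (sym (signs k)))

  base-alternating₄ : ∀ k → Alternating₄ a (base D + + 2 * k)
  base-alternating₄ k i _ = trans (cong a (idx (base D) k (+ i)))
    (trans (alternating D (k + + i)) (cong (neg ∘ a) (idx′ (base D) k (+ i))))
    where
    idx : ∀ h k i → h + + 2 * k + + 2 * (+ 1 + i) ≡ h + + 2 * (k + i + + 1)
    idx = solve-∀
    idx′ : ∀ h k i → h + + 2 * (k + i) ≡ h + + 2 * k + + 2 * i
    idx′ = solve-∀

  -- A finite window recognises the phase: on the wrong parity the four signs would be consecutive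
  -- alternating entries of the derived folding sequence.
  alternating₄-base : ∀ y → Alternating₄ a y → ∃[ k ] (y ≡ base D + + 2 * k)
  alternating₄-base y alt with parity-from (base D) y
  ... | k , inj₁ e = k , e
  ... | k , inj₂ refl = ⊥-elim (not-alternating (λ k → a (base D + + 2 * k + + 1)) k (word-window (derived D) k 4)
      (λ i p → trans (cong a (idx (base D) k (+ suc i))) (trans (alt i p) (cong (neg ∘ a) (sym (idx (base D) k (+ i)))))))
    where
    idx : ∀ h k i → h + + 2 * (k + i) + + 1 ≡ h + + 2 * k + + 1 + + 2 * i
    idx = solve-∀

  -- The derived sequence has alternating places of its own at distance two; these lie at distance
  -- four in `a` and supply the required `h₁`.
  E₁-intro : ∀ k → InE1 a (base D + + 2 * k + + 1)
  E₁-intro k = base D + + 2 * h′ + + 1 , alt , Signed.∣⇒∣ᵤ (Signed.divides (k - h′) (even (base D) k h′))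
    where
    D′ = derivation (derived D)
    h′ = base D′
    even : ∀ h k h′ → (h + + 2 * k + + 1) - (h + + 2 * h′ + + 1) ≡ (k - h′) * + 2
    even = solve-∀
    idx : ∀ h h′ k → h + + 2 * h′ + + 1 + + 4 * k ≡ h + + 2 * (h′ + + 2 * k) + + 1
    idx = solve-∀
    alt : ∀ k → a (base D + + 2 * h′ + + 1 + + 4 * k) ≡ signPow k (a (base D + + 2 * h′ + + 1))
    alt k = trans (cong a (idx (base D) h′ k))
      (trans (alternates⇒signPow (λ k → a (base D + + 2 * (h′ + + 2 * k) + + 1)) (alternating D′) k)
             (cong (λ z → signPow k (a (base D + + 2 * z + + 1))) (ℤₚ.+-identityʳ h′)))

  -- On the base places the signs repeat with period four, while `h₁` requires a change of sign
  -- after four; so `h₁` has the other parity.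
  E₁-elim : ∀ i → InE1 a i → ∃[ k ] (i ≡ base D + + 2 * k + + 1)
  E₁-elim i (h₁ , alt , div) with Signed.∣ᵤ⇒∣ {+ 2} {i - h₁} div | parity-from (base D) h₁
  ... | _ | k , inj₁ refl = ⊥-elim (neg-irrefl (a (base D + + 2 * k))
      (trans (sym (signs-even k (+ 1))) (trans (cong a (idx (base D) k)) (alt (+ 1)))))
    where
    idx : ∀ h k → h + + 2 * (k + + 2 * + 1) ≡ h + + 2 * k + + 4 * + 1
    idx = solve-∀
  ... | Signed.divides q e | k , inj₂ refl = q + k , trans (lem i (base D + + 2 * k + + 1)) (trans (cong (_+ (base D + + 2 * k + + 1)) e) (idx (base D) k q))
    where
    lem : ∀ i h → i ≡ i - h + h
    lem = solve-∀
    idx : ∀ h k q → q * + 2 + (h + + 2 * k + + 1) ≡ h + + 2 * (q + k) + + 1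
    idx = solve-∀

-- Points and directions

,-cong : ∀ {a b c d : ℤ} → a ≡ c → b ≡ d → _≡_ {A = Point} (a , b) (c , d)
,-cong refl refl = refl

⊕-assoc : ∀ p q r → (p ⊕ q) ⊕ r ≡ p ⊕ (q ⊕ r)
⊕-assoc (a , b) (c , d) (e , f) = ,-cong (ℤₚ.+-assoc a c e) (ℤₚ.+-assoc b d f)

⊕-comm : ∀ p q → p ⊕ q ≡ q ⊕ p
⊕-comm (a , b) (c , d) = ,-cong (ℤₚ.+-comm a c) (ℤₚ.+-comm b d)

⊕-identityʳ : ∀ p → p ⊕ (+ 0 , + 0) ≡ p
⊕-identityʳ (a , b) = ,-cong (ℤₚ.+-identityʳ a) (ℤₚ.+-identityʳ b)

⊖_ : Point → Point
⊖ (a , b) = - a , - b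

⊕-inverseʳ : ∀ p → p ⊕ (⊖ p) ≡ (+ 0 , + 0)
⊕-inverseʳ (a , b) = ,-cong (ℤₚ.+-inverseʳ a) (ℤₚ.+-inverseʳ b)

⊕-cancelʳ : ∀ p q r → p ⊕ r ≡ q ⊕ r → p ≡ q
⊕-cancelʳ p q r e = trans (sym (undo p)) (trans (cong (_⊕ (⊖ r)) e) (undo q))
  where
  undo : ∀ p → (p ⊕ r) ⊕ (⊖ r) ≡ p
  undo p = trans (⊕-assoc p r (⊖ r)) (trans (cong (p ⊕_) (⊕-inverseʳ r)) (⊕-identityʳ p))

rot : Sign → Dir → Dir
rot plus  E = N
rot plus  N = W
rot plus  W = S
rot plus  S = E
rot minus E = S
rot minus N = E
rot minus W = N
rot minus S = W

opp : Dir → Dir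
opp E = W
opp N = S
opp W = E
opp S = N

∀-sign : ∀ {P : Sign → Set} → P plus → P minus → ∀ s → P s
∀-sign p m plus  = p
∀-sign p m minus = m

∀-dir : ∀ {P : Dir → Set} → P E → P N → P W → P S → ∀ d → P d
∀-dir e n w s E = e
∀-dir e n w s N = n
∀-dir e n w s W = w
∀-dir e n w s S = s

opp-involutive : ∀ d → opp (opp d) ≡ d
opp-involutive = ∀-dir refl refl refl refl

step-opp : ∀ d → step d ⊕ step (opp d) ≡ (+ 0 , + 0)
step-opp = ∀-dir refl refl refl refl

there-and-back : ∀ p d → (p ⊕ step d) ⊕ step (opp d) ≡ p
there-and-back p d = trans (⊕-assoc p (step d) (step (opp d)))
  (trans (cong (p ⊕_) (step-opp d)) (⊕-identityʳ p))

-- Multiplication by 1 + i, with points read as Gaussian integers.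
M : Point → Point
M (x , y) = x - y , x + y

M-⊕ : ∀ p q → M (p ⊕ q) ≡ M p ⊕ M q
M-⊕ (a , b) (c , d) = ,-cong (lem₁ a b c d) (lem₂ a b c d)
  where
  lem₁ : ∀ a b c d → a + c - (b + d) ≡ a - b + (c - d)
  lem₁ = solve-∀
  lem₂ : ∀ a b c d → a + c + (b + d) ≡ a + b + (c + d)
  lem₂ = solve-∀

M-injective : ∀ p q → M p ≡ M q → p ≡ q
M-injective (a , b) (c , d) e = ,-cong
  (ℤₚ.*-cancelˡ-≡ (+ 2) a c (trans (x a b) (trans (cong₂ _+_ (cong proj₁ e) (cong proj₂ e)) (sym (x c d)))))
  (ℤₚ.*-cancelˡ-≡ (+ 2) b d (trans (y a b) (trans (cong₂ _-_ (cong proj₂ e) (cong proj₁ e)) (sym (y c d)))))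
  where
  x : ∀ a b → + 2 * a ≡ a - b + (a + b)
  x = solve-∀
  y : ∀ a b → + 2 * b ≡ a + b - (a - b)
  y = solve-∀

-- The checkerboard colouring whose value at the origin is `s`.
colour : Sign → Point → Sign
colour s (x , y) = signPow (x + y) s

colour-⊕ : ∀ s p q → colour s (p ⊕ q) ≡ colour (colour s q) p
colour-⊕ s (a , b) (c , d) = trans (cong (λ z → signPow z s) (lem a b c d)) (signPow-+ (a + b) (c + d) s)
  where
  lem : ∀ a b c d → a + c + (b + d) ≡ a + b + (c + d)
  lem = solve-∀

colour-neg : ∀ s p → colour (neg s) p ≡ neg (colour s p)
colour-neg s (x , y) = signPow-neg (x + y)
  where
  signPow-neg : ∀ k → signPow k (neg s) ≡ neg (signPow k s)
  signPow-neg (+ n)    = flipN-neg n s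
  signPow-neg -[1+ n ] = flipN-neg (suc n) s

colour-step : ∀ s p d → colour s (p ⊕ step d) ≡ neg (colour s p)
colour-step s p d = trans (colour-⊕ s p (step d))
  (trans (cong (λ z → colour z p) (∀-dir {λ d → colour s (step d) ≡ neg s} refl refl refl refl d)) (colour-neg s p))

colour-involutive : ∀ s p → colour (colour s p) p ≡ s
colour-involutive s (x , y) = signPow-involutive (x + y) s

-- Walks with a complete folding sequence of turns, and their coarsenings

record Walk : Set where
  field
    turns   : Seq
    pos     : ℤ → Point
    heading : ℤ → Dir
    advance : ∀ i → pos (i + + 1) ≡ pos i ⊕ step (heading i)
    rotate  : ∀ i → heading (i + + 1) ≡ rot (turns i) (heading i)
    folds   : CompleteFoldingSeq turns
open Walk

-- An unoriented edge is named by one endpoint and the direction leaving it. Each edge has two such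
-- names, and the four edges at a vertex are treated uniformly.
record Covered (w : Walk) (q : Point) (δ : Dir) : Set where
  constructor covered
  field
    index : ℤ
    match : (pos w index ≡ q × heading w index ≡ δ) ⊎
            (pos w index ≡ q ⊕ step δ × heading w index ≡ opp δ)

Covered-reverse : ∀ {w q δ} → Covered w q δ → Covered w (q ⊕ step δ) (opp δ)
Covered-reverse {w} {q} {δ} (covered k (inj₁ (e , f))) =
  covered k (inj₂ (trans e (sym (there-and-back q δ)) , trans f (sym (opp-involutive δ))))
Covered-reverse {w} {q} {δ} (covered k (inj₂ (e , f))) = covered k (inj₁ (e , f))

-- Two unit steps in directions d and rot s d add up to 1 + i times a step in direction
-- coarseDir s d; fineDir s recovers d.
coarseDir fineDir : Sign → Dir → Dir
coarseDir plus  d = d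
coarseDir minus d = rot minus d
fineDir plus  δ = δ
fineDir minus δ = rot plus δ

fine-coarse : ∀ s d → fineDir s (coarseDir s d) ≡ d
fine-coarse = ∀-sign (∀-dir refl refl refl refl) (∀-dir refl refl refl refl)

two-steps : ∀ s d → step d ⊕ step (rot s d) ≡ M (step (coarseDir s d))
two-steps = ∀-sign (∀-dir refl refl refl refl) (∀-dir refl refl refl refl)

-- The next alternating turn has sign `neg s`. With this change the turn between two joined steps is
-- the intermediate turn `e`, so the coarse walk turns according to the derived sequence.
coarse-turn : ∀ s e d → coarseDir (neg s) (rot e (rot s d)) ≡ rot e (coarseDir s d)
coarse-turn = ∀-sign (∀-sign (∀-dir refl refl refl refl) (∀-dir refl refl refl refl))
                     (∀-sign (∀-dir refl refl refl refl) (∀-dir refl refl refl refl))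

reverse-dir : ∀ s δ → rot (neg s) (fineDir (neg s) (opp δ)) ≡ opp (fineDir s δ)
reverse-dir = ∀-sign (∀-dir refl refl refl refl) (∀-dir refl refl refl refl)

reverse-step : ∀ s δ → M (step δ) ⊕ step (fineDir (neg s) (opp δ)) ≡ step (fineDir s δ)
reverse-step = ∀-sign (∀-dir refl refl refl refl) (∀-dir refl refl refl refl)

M-shift : ∀ o q p → (M q ⊕ o) ⊕ M p ≡ M (q ⊕ p) ⊕ o
M-shift o q p = trans (⊕-assoc (M q) o (M p)) (trans (cong (M q ⊕_) (⊕-comm o (M p)))
  (trans (sym (⊕-assoc (M q) (M p) o)) (cong (_⊕ o) (sym (M-⊕ q p)))))

module Coarsening (w : Walk) where

  D : Derivation (turns w)
  D = derivation (folds w)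

  fine : ℤ → ℤ
  fine k = base D + + 2 * k

  fine-suc : ∀ k → fine (k + + 1) ≡ fine k + + 1 + + 1
  fine-suc k = lem (base D) k
    where
    lem : ∀ h k → h + + 2 * (k + + 1) ≡ h + + 2 * k + + 1 + + 1
    lem = solve-∀

  sign : ℤ → Sign
  sign k = turns w (fine k)

  heading′ : ℤ → Dir
  heading′ k = coarseDir (sign k) (heading w (fine k))

  origin : Point
  origin = pos w (base D)

  heading-fine : ∀ k → heading w (fine k) ≡ fineDir (sign k) (heading′ k)
  heading-fine k = sym (fine-coarse (sign k) _)

  heading-fine+1 : ∀ k → heading w (fine k + + 1) ≡ rot (sign k) (fineDir (sign k) (heading′ k))
  heading-fine+1 k = trans (rotate w (fine k)) (cong (rot (sign k)) (heading-fine k))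

  rotate′ : ∀ k → heading′ (k + + 1) ≡ rot (turns w (fine k + + 1)) (heading′ k)
  rotate′ k = trans (cong₂ coarseDir (alternating D k)
      (trans (cong (heading w) (fine-suc k)) (trans (rotate w (fine k + + 1)) (cong (rot _) (rotate w (fine k))))))
    (coarse-turn (sign k) (turns w (fine k + + 1)) (heading w (fine k)))

  pos-fine-suc : ∀ k → pos w (fine (k + + 1)) ≡ pos w (fine k) ⊕ M (step (heading′ k))
  pos-fine-suc k = begin
    pos w (fine (k + + 1))                            ≡⟨ cong (pos w) (fine-suc k) ⟩
    pos w (fine k + + 1 + + 1)                        ≡⟨ advance w (fine k + + 1) ⟩
    pos w (fine k + + 1) ⊕ step (heading w (fine k + + 1))
      ≡⟨ cong₂ (λ x y → x ⊕ step y) (advance w (fine k)) (rotate w (fine k)) ⟩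
    (pos w (fine k) ⊕ step d) ⊕ step (rot (sign k) d) ≡⟨ ⊕-assoc (pos w (fine k)) (step d) _ ⟩
    pos w (fine k) ⊕ (step d ⊕ step (rot (sign k) d)) ≡⟨ cong (pos w (fine k) ⊕_) (two-steps (sign k) d) ⟩
    pos w (fine k) ⊕ M (step (heading′ k))            ∎
    where
    open ≡-Reasoning
    d = heading w (fine k)

  coarse-pos : ∀ k → ∃[ q ] (pos w (fine k) ≡ M q ⊕ origin)
  coarse-pos = ℤ-induction _ start₀ up down
    where
    start₀ : ∃[ q ] (pos w (fine (+ 0)) ≡ M q ⊕ origin)
    start₀ = (+ 0 , + 0) , trans (cong (pos w) (ℤₚ.+-identityʳ (base D)))
      (,-cong (sym (ℤₚ.+-identityˡ _)) (sym (ℤₚ.+-identityˡ _)))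
    up : ∀ k → ∃[ q ] (pos w (fine k) ≡ M q ⊕ origin) → ∃[ q ] (pos w (fine (k + + 1)) ≡ M q ⊕ origin)
    up k (q , e) = q ⊕ step (heading′ k) ,
      trans (pos-fine-suc k) (trans (cong (_⊕ M (step (heading′ k))) e) (M-shift origin q _))
    down : ∀ k → ∃[ q ] (pos w (fine (k + + 1)) ≡ M q ⊕ origin) → ∃[ q ] (pos w (fine k) ≡ M q ⊕ origin)
    down k (q , e) = q ⊕ step (opp δ) , ⊕-cancelʳ _ _ (M (step δ))
      (trans (sym (pos-fine-suc k)) (trans e (trans (cong (λ z → M z ⊕ origin) (sym back)) (sym (M-shift origin (q ⊕ step (opp δ)) (step δ))))))
      where
      δ = heading′ k
      back : (q ⊕ step (opp δ)) ⊕ step δ ≡ q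
      back = trans (cong (λ z → (q ⊕ step (opp δ)) ⊕ step z) (sym (opp-involutive δ))) (there-and-back q (opp δ))

  pos′ : ℤ → Point
  pos′ k = proj₁ (coarse-pos k)

  pos-fine : ∀ k → pos w (fine k) ≡ M (pos′ k) ⊕ origin
  pos-fine k = proj₂ (coarse-pos k)

  advance′ : ∀ k → pos′ (k + + 1) ≡ pos′ k ⊕ step (heading′ k)
  advance′ k = M-injective _ _ (⊕-cancelʳ _ _ origin (trans (sym (pos-fine (k + + 1)))
    (trans (pos-fine-suc k) (trans (cong (_⊕ M (step (heading′ k))) (pos-fine k)) (M-shift origin (pos′ k) _)))))

  coarse : Walk
  coarse = record
    { turns = λ k → turns w (fine k + + 1) ; pos = pos′ ; heading = heading′
    ; advance = advance′ ; rotate = rotate′ ; folds = derived D }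

  -- `colour` with a fixed point is an involution on signs, so this is the value at the origin that
  -- gives `pos′ (+ 0)` the sign of the first alternating turn.
  σ : Sign
  σ = colour (turns w (base D)) (pos′ (+ 0))

  -- Every coarse step changes both the checkerboard colour and the alternating sign. Hence the sign
  -- depends on the place visited and not on the moment of the visit.
  colour-pos′ : ∀ k → colour σ (pos′ k) ≡ sign k
  colour-pos′ k = begin
    colour σ (pos′ k)
      ≡⟨ alternates⇒signPow (λ k → colour σ (pos′ k)) (λ k → trans (cong (colour σ) (advance′ k)) (colour-step σ (pos′ k) (heading′ k))) k ⟩
    signPow k (colour σ (pos′ (+ 0))) ≡⟨ cong (signPow k) (colour-involutive _ (pos′ (+ 0))) ⟩
    signPow k (turns w (base D))      ≡⟨ signs D k ⟨
    sign k                            ∎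
    where open ≡-Reasoning

  -- A coarse edge refines to the same two fine edges whichever way it is traversed: the
  -- starting points of the two traversals have opposite colours.
  refine : ∀ q δ → Covered coarse q δ → Covered w (M q ⊕ origin) (fineDir (colour σ q) δ)
  refine q δ (covered k (inj₁ (refl , refl))) = covered (fine k) (inj₁ (pos-fine k ,
    trans (heading-fine k) (cong (λ z → fineDir z (heading′ k)) (sym (colour-pos′ k)))))
  refine q δ (covered k (inj₂ (e , f))) = covered (fine k + + 1) (inj₂ (here , dir′))
    where
    s = colour σ q
    sign≡ : sign k ≡ neg s
    sign≡ = trans (sym (colour-pos′ k)) (trans (cong (colour σ) e) (colour-step σ q δ))
    fineDir≡ : fineDir (sign k) (heading′ k) ≡ fineDir (neg s) (opp δ)
    fineDir≡ = cong₂ fineDir sign≡ f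
    dir′ : heading w (fine k + + 1) ≡ opp (fineDir s δ)
    dir′ = trans (heading-fine+1 k) (trans (cong₂ rot sign≡ fineDir≡) (reverse-dir s δ))
    here : pos w (fine k + + 1) ≡ (M q ⊕ origin) ⊕ step (fineDir s δ)
    here = begin
      pos w (fine k + + 1) ≡⟨ advance w (fine k) ⟩
      pos w (fine k) ⊕ step (heading w (fine k))
        ≡⟨ cong₂ (λ x y → x ⊕ step y) (trans (pos-fine k) (cong (λ z → M z ⊕ origin) e)) (trans (heading-fine k) fineDir≡) ⟩
      (M (q ⊕ step δ) ⊕ origin) ⊕ step (fineDir (neg s) (opp δ))
        ≡⟨ cong (_⊕ step (fineDir (neg s) (opp δ))) (sym (M-shift origin q (step δ))) ⟩
      ((M q ⊕ origin) ⊕ M (step δ)) ⊕ step (fineDir (neg s) (opp δ))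
        ≡⟨ ⊕-assoc (M q ⊕ origin) (M (step δ)) _ ⟩
      (M q ⊕ origin) ⊕ (M (step δ) ⊕ step (fineDir (neg s) (opp δ)))
        ≡⟨ cong ((M q ⊕ origin) ⊕_) (reverse-step s δ) ⟩
      (M q ⊕ origin) ⊕ step (fineDir s δ) ∎
      where open ≡-Reasoning

record Coarsened (w : Walk) : Set where
  field
    D              : Derivation (turns w)
    coarse         : Walk
    turns-coarse   : ∀ k → turns coarse k ≡ turns w (base D + + 2 * k + + 1)
    heading-fine   : ∀ k → heading w (base D + + 2 * k) ≡ fineDir (turns w (base D + + 2 * k)) (heading coarse k)
    origin         : Point
    σ              : Sign
    refine         : ∀ q δ → Covered coarse q δ → Covered w (M q ⊕ origin) (fineDir (colour σ q) δ)

-- Abstract, because conversion checking must not unfold iterated coarsenings.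
abstract
  coarsened : ∀ w → Coarsened w
  coarsened w = record
    { D = D ; coarse = coarse ; turns-coarse = λ _ → refl ; heading-fine = heading-fine
    ; origin = origin ; σ = σ ; refine = refine }
    where open Coarsening w

coarsen : Walk → Walk
coarsen w = Coarsened.coarse (coarsened w)

-- Full vertices

Full : Walk → Point → Set
Full w q = ∀ δ → Covered w q δ

Covered-at : ∀ {w p q δ ε} → p ≡ q → δ ≡ ε → Covered w p δ → Covered w q ε
Covered-at refl refl c = c

module Refinement (w : Walk) where
  open Coarsened (coarsened w)

  φ : Point → Point
  φ q = M q ⊕ origin

  φ-⊕ : ∀ q p → φ (q ⊕ p) ≡ φ q ⊕ M p
  φ-⊕ q p = sym (M-shift origin q p)

  φ-shift : ∀ q p s t → M p ⊕ s ≡ t → φ (q ⊕ p) ⊕ s ≡ φ q ⊕ t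
  φ-shift q p s t e = trans (cong (_⊕ s) (φ-⊕ q p)) (trans (⊕-assoc (φ q) (M p) s) (cong (φ q ⊕_) e))

  -- The fine edge in direction `δ` comes from the coarse edge `δ` if the colour is `plus`, and from
  -- its clockwise neighbour if it is `minus`. Having both makes the colour irrelevant.
  refine-either : ∀ q δ → Covered coarse q δ → Covered coarse q (rot minus δ) → Covered w (φ q) δ
  refine-either q δ c₊ c₋ = ∀-sign {λ s → colour σ q ≡ s → Covered w (φ q) δ}
    (λ e → Covered-at refl (cong (λ z → fineDir z δ) e) (refine q δ c₊))
    (λ e → Covered-at refl (trans (cong (λ z → fineDir z (rot minus δ)) e) (fine-coarse minus δ)) (refine q (rot minus δ) c₋))
    (colour σ q) refl

  full-vertex : ∀ {q} → Full coarse q → Full w (φ q)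
  full-vertex {q} f δ = refine-either q δ (f δ) (f (rot minus δ))

  -- The centre of the refined square is adjacent to the images of the four corners. The fine edge
  -- from a corner to the centre comes from one of the two sides meeting at that corner.
  full-centre : ∀ q → Covered coarse q E → Covered coarse q N →
    Covered coarse (q ⊕ step E) N → Covered coarse (q ⊕ step N) E → Full w (φ q ⊕ step N)
  full-centre q bottom left right top = ∀-dir
    (from (q ⊕ step E) W (φ-shift q (step E) (step W) (step N) refl)
      (Covered-reverse bottom) right)
    (from ((q ⊕ step E) ⊕ step N) S
      (trans (cong (λ z → φ z ⊕ step S) (⊕-assoc q (step E) (step N))) (φ-shift q (step E ⊕ step N) (step S) (step N) refl))
      (Covered-reverse right) (Covered-at (sym corner) refl (Covered-reverse top)))
    (from (q ⊕ step N) E (φ-shift q (step N) (step E) (step N) refl)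
      top (Covered-reverse left))
    (from q N refl left bottom)
    where
    corner : (q ⊕ step E) ⊕ step N ≡ (q ⊕ step N) ⊕ step E
    corner = trans (⊕-assoc q (step E) (step N)) (sym (⊕-assoc q (step N) (step E)))
    from : ∀ r δ → φ r ⊕ step δ ≡ φ q ⊕ step N → Covered coarse r δ → Covered coarse r (rot minus δ) →
      Covered w (φ q ⊕ step N) (opp δ)
    from r δ e c₊ c₋ = Covered-at e refl (Covered-reverse (refine-either r δ c₊ c₋))

  full-diagonal : ∀ q → Full coarse q → Full coarse (q ⊕ (+ 1 , + 1)) → Full w (φ q ⊕ step N)
  full-diagonal q f g = full-centre q (f E) (f N)
    (Covered-at (⊕-assoc q (+ 1 , + 1) (step S)) refl (Covered-reverse (g S)))
    (Covered-at (⊕-assoc q (+ 1 , + 1) (step W)) refl (Covered-reverse (g W)))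

  full-antidiagonal : ∀ q → Full coarse (q ⊕ step E) → Full coarse (q ⊕ step N) → Full w (φ q ⊕ step N)
  full-antidiagonal q f g = full-centre q
    (Covered-at (there-and-back q E) refl (Covered-reverse (f W)))
    (Covered-at (there-and-back q N) refl (Covered-reverse (g S)))
    (f N) (g E)

  -- One of the two unit squares on the edge from q to q ⊕ step E receives no refinement of
  -- that edge; all four fine edges at its centre then come from edges at q and q ⊕ step E.
  full-pair : ∀ q → Full coarse q → Full coarse (q ⊕ step E) →
    Full w (φ q ⊕ step E) ⊎ Full w (φ q ⊕ step N)
  full-pair q f g = ∀-sign {λ s → colour σ q ≡ s → Full w (φ q ⊕ step E) ⊎ Full w (φ q ⊕ step N)}
    (λ e → inj₂ (above e)) (λ e → inj₁ (below e)) (colour σ q) refl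
    where
    at-colour : ∀ {r s δ ε} → colour σ r ≡ s → fineDir s δ ≡ ε → Covered coarse r δ → Covered w (φ r) ε
    at-colour {r} {δ = δ} e e′ c = Covered-at refl (trans (cong (λ z → fineDir z δ) e) e′) (refine r δ c)
    next : ∀ {s} d → colour σ q ≡ s → colour σ (q ⊕ step d) ≡ neg s
    next d e = trans (colour-step σ q d) (cong neg e)
    next₂ : ∀ {s} d d′ → colour σ q ≡ s → colour σ ((q ⊕ step d) ⊕ step d′) ≡ s
    next₂ d d′ e = trans (colour-step σ (q ⊕ step d) d′) (trans (cong neg (next d e)) (neg-involutive _))
    into : ∀ {c} p δ → φ p ⊕ step δ ≡ c → Covered w (φ p) δ → Covered w c (opp δ)
    into p δ e c = Covered-at e refl (Covered-reverse c)
    above : colour σ q ≡ plus → Full w (φ q ⊕ step N)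
    above e = ∀-dir
      (into (q ⊕ step E) W (φ-shift q (step E) (step W) (step N) refl) (full-vertex g W))
      (into ((q ⊕ step E) ⊕ step N) S
        (trans (cong (λ z → φ z ⊕ step S) (⊕-assoc q (step E) (step N))) (φ-shift q (step E ⊕ step N) (step S) (step N) refl))
        (at-colour (next₂ E N e) refl (Covered-reverse (g N))))
      (into (q ⊕ step N) E (φ-shift q (step N) (step E) (step N) refl)
        (at-colour (next N e) refl (Covered-reverse (f N))))
      (into q N refl (full-vertex f N))
    below : colour σ q ≡ minus → Full w (φ q ⊕ step E)
    below e = ∀-dir
      (into ((q ⊕ step E) ⊕ step S) W
        (trans (cong (λ z → φ z ⊕ step W) (⊕-assoc q (step E) (step S))) (φ-shift q (step E ⊕ step S) (step W) (step E) refl))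
        (at-colour (next₂ E S e) refl (Covered-reverse (g S))))
      (into (q ⊕ step E) S (φ-shift q (step E) (step S) (step E) refl) (full-vertex g S))
      (into q E refl (full-vertex f E))
      (into (q ⊕ step S) N (φ-shift q (step S) (step N) (step E) refl)
        (at-colour (next S e) refl (Covered-reverse (f S))))

-- Two refinements at a time and the growth of full blocks

module Refinement² (w : Walk) where
  private
    w′ = coarsen w
    w″ = coarsen w′
  module R  = Refinement w
  module R′ = Refinement w′

  φ² : Point → Point
  φ² q = R.φ (R′.φ q)

  -- Multiplication by (1 + i)² = 2i: a quarter turn followed by doubling.
  φ²-⊕ : ∀ q i j → φ² (q ⊕ (i , j)) ≡ φ² q ⊕ (- (+ 2 * j) , + 2 * i)
  φ²-⊕ q i j = trans (cong R.φ (R′.φ-⊕ q (i , j))) (trans (R.φ-⊕ (R′.φ q) (M (i , j)))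
    (cong (φ² q ⊕_) (,-cong (lem₁ i j) (lem₂ i j))))
    where
    lem₁ : ∀ i j → i - j - (i + j) ≡ - (+ 2 * j)
    lem₁ = solve-∀
    lem₂ : ∀ i j → i - j + (i + j) ≡ + 2 * i
    lem₂ = solve-∀

  full²-vertex : ∀ q → Full w″ q → Full w (φ² q)
  full²-vertex q f = R.full-vertex (R′.full-vertex f)

  -- After one refinement the two vertices are opposite corners of a unit square, whose centre
  -- becomes the midpoint of their images after the second. `full²-N` is the same with the other
  -- diagonal.
  full²-E : ∀ q → Full w″ q → Full w″ (q ⊕ step E) → Full w (φ² q ⊕ step N)
  full²-E q f g = R.full-diagonal (R′.φ q) (R′.full-vertex f)
    (subst (Full w′) (R′.φ-⊕ q (step E)) (R′.full-vertex g))

  full²-N : ∀ q → Full w″ q → Full w″ (q ⊕ step N) → Full w (φ² q ⊕ step W)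
  full²-N q f g = subst (Full w) (R.φ-shift (R′.φ q) (step W) (step N) (step W) refl)
    (R.full-antidiagonal (R′.φ q ⊕ step W)
      (subst (Full w′) (sym (there-and-back (R′.φ q) W)) (R′.full-vertex f))
      (subst (Full w′) (trans (R′.φ-⊕ q (step N)) (sym (⊕-assoc (R′.φ q) (step W) (step N)))) (R′.full-vertex g)))

  full²-centre : ∀ q → Full w″ q → Full w″ (q ⊕ (+ 1 , + 1)) → Full w (φ² q ⊕ (-[1+ 0 ] , + 1))
  full²-centre q f g = subst (Full w) (R.φ-⊕ (R′.φ q) (step N)) (R.full-vertex (R′.full-diagonal q f g))

Block : Walk → ℕ → Point → Set
Block w n q = ∀ i j → i ℕ.≤ n → j ℕ.≤ n → Full w (q ⊕ (+ i , + j))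

module _ (w : Walk) where
  open Refinement² w
  private
    w′ = coarsen w
    w″ = coarsen w′

  -- The four parity cases are images of vertices, midpoints of the two kinds of sides, and centres
  -- of squares. The quarter turn sends rows to columns running leftwards, so the block extends
  -- `2 * n` to the left of `φ² q`, and the column is read from the parity of `double n ∸ I`.
  block-double : ∀ n q → Block w″ n q → Block w (double n) (φ² q ⊕ (- (+ 2 * + n) , + 0))
  block-double n q b I J I≤ J≤ with ℕ-parity (double n ℕ.∸ I) | ℕ-parity J
  ... | j , I′ | i , J′ = cases I′ J′
    where
    odd-< : ∀ m → suc (double m) ℕ.≤ double n → suc m ℕ.≤ n
    odd-< m le = double-cancel-≤ (suc m) n (s≤s le)
    even-≤ : ∀ m → double m ℕ.≤ double n → m ℕ.≤ n
    even-≤ m le = double-cancel-≤ m n (ℕₚ.m≤n⇒m≤1+n le)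
    r : Point
    r = q ⊕ (+ i , + j)
    target : ∀ I′ v → double n ℕ.∸ I ≡ I′ → (- (+ 2 * + j) , + 2 * + i) ⊕ v ≡ (- (+ I′) , + J) →
      φ² r ⊕ v ≡ (φ² q ⊕ (- (+ 2 * + n) , + 0)) ⊕ (+ I , + J)
    target I′ v e e′ = trans (cong (_⊕ v) (φ²-⊕ q (+ i) (+ j))) (trans (⊕-assoc (φ² q) (- (+ 2 * + j) , + 2 * + i) v)
      (trans (cong (φ² q ⊕_) (trans e′ (,-cong x≡ (sym (ℤₚ.+-identityˡ (+ J)))))) (sym (⊕-assoc (φ² q) (- (+ 2 * + n) , + 0) (+ I , + J)))))
      where
      lem : ∀ x y → - x ≡ - (x + y) + y
      lem = solve-∀
      x≡ : - (+ I′) ≡ - (+ 2 * + n) + + I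
      x≡ = trans (lem (+ I′) (+ I)) (cong (λ z → - z + + I)
        (trans (cong +_ (trans (cong (ℕ._+ I) (sym e)) (ℕₚ.m∸n+n≡m I≤))) (+double n)))
    shift : ∀ {i′ j′} → i′ ℕ.≤ n → j′ ℕ.≤ n → ∀ v → (+ i , + j) ⊕ v ≡ (+ i′ , + j′) → Full w″ (r ⊕ v)
    shift p p′ v e = subst (Full w″) (trans (cong (q ⊕_) (sym e)) (sym (⊕-assoc q (+ i , + j) v))) (b _ _ p p′)
    x-even : - (+ 2 * + j) + + 0 ≡ - (+ double j)
    x-even = trans (ℤₚ.+-identityʳ _) (cong -_ (sym (+double j)))
    x-odd : - (+ 2 * + j) + -[1+ 0 ] ≡ - (+ suc (double j))
    x-odd = trans (lem (+ 2 * + j)) (cong (λ z → - (+ 1 + z)) (sym (+double j)))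
      where
      lem : ∀ x → - x + -[1+ 0 ] ≡ - (+ 1 + x)
      lem = solve-∀
    y-even : + 2 * + i + + 0 ≡ + double i
    y-even = trans (ℤₚ.+-identityʳ _) (sym (+double i))
    y-odd : + 2 * + i + + 1 ≡ + suc (double i)
    y-odd = trans (ℤₚ.+-comm (+ 2 * + i) (+ 1)) (cong (λ z → + 1 + z) (sym (+double i)))
    i+1 : + i + + 1 ≡ + suc i
    i+1 = ℤₚ.+-comm (+ i) (+ 1)
    j+1 : + j + + 1 ≡ + suc j
    j+1 = ℤₚ.+-comm (+ j) (+ 1)
    i+0 : + i + + 0 ≡ + i
    i+0 = ℤₚ.+-identityʳ (+ i)
    j+0 : + j + + 0 ≡ + j
    j+0 = ℤₚ.+-identityʳ (+ j)
    I′≤ : ∀ {m} → double n ℕ.∸ I ≡ m → m ℕ.≤ double n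
    I′≤ refl = ℕₚ.m∸n≤m (double n) I
    cases : (double n ℕ.∸ I ≡ double j ⊎ double n ℕ.∸ I ≡ suc (double j)) →
            (J ≡ double i ⊎ J ≡ suc (double i)) →
            Full w ((φ² q ⊕ (- (+ 2 * + n) , + 0)) ⊕ (+ I , + J))
    cases (inj₁ e) (inj₁ refl) = subst (Full w)
      (trans (sym (⊕-identityʳ (φ² r))) (target _ (+ 0 , + 0) e (,-cong x-even y-even)))
      (full²-vertex r (b i j (even-≤ i J≤) (even-≤ j (I′≤ e))))
    cases (inj₁ e) (inj₂ refl) = subst (Full w) (target _ (step N) e (,-cong x-even y-odd))
      (full²-E r (b i j (ℕₚ.<⇒≤ (odd-< i J≤)) (even-≤ j (I′≤ e)))
        (shift (odd-< i J≤) (even-≤ j (I′≤ e)) (step E) (,-cong i+1 j+0)))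
    cases (inj₂ e) (inj₁ refl) = subst (Full w) (target _ (step W) e (,-cong x-odd y-even))
      (full²-N r (b i j (even-≤ i J≤) (ℕₚ.<⇒≤ (odd-< j (I′≤ e))))
        (shift (even-≤ i J≤) (odd-< j (I′≤ e)) (step N) (,-cong i+0 j+1)))
    cases (inj₂ e) (inj₂ refl) = subst (Full w) (target _ (-[1+ 0 ] , + 1) e (,-cong x-odd y-odd))
      (full²-centre r (b i j (ℕₚ.<⇒≤ (odd-< i J≤)) (ℕₚ.<⇒≤ (odd-< j (I′≤ e))))
        (shift (odd-< i J≤) (odd-< j (I′≤ e)) (+ 1 , + 1) (,-cong i+1 j+1)))

unit-block : ∀ w q → Full w q → Full w (q ⊕ step E) → Full w (q ⊕ step N) → Full w (q ⊕ (+ 1 , + 1)) → Block w 1 q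
unit-block w q a b c d 0 0 _ _ = subst (Full w) (sym (⊕-identityʳ q)) a
unit-block w q a b c d 1 0 _ _ = b
unit-block w q a b c d 0 1 _ _ = c
unit-block w q a b c d 1 1 _ _ = d
unit-block w q a b c d (suc (suc _)) _ (s≤s ()) _
unit-block w q a b c d _ (suc (suc _)) _ (s≤s ())

module _ (w : Walk) where
  open Refinement² w
  private
    w′ = coarsen w
    w″ = coarsen w′

  -- Three full corners of a unit square cover a right triangle, which contains a unit square
  -- two refinements further down.
  block-from-corner-E : ∀ q → Full w″ q → Full w″ (q ⊕ step E) → Full w″ (q ⊕ (+ 1 , + 1)) →
    Block w 1 (φ² q ⊕ (-[1+ 0 ] , + 1))
  block-from-corner-E q a b c = unit-block w (φ² q ⊕ (-[1+ 0 ] , + 1))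
    (full²-centre q a c)
    (subst (Full w) (sym (⊕-assoc (φ² q) (-[1+ 0 ] , + 1) (step E))) (full²-E q a b))
    (subst (Full w) (trans (move² (step W)) (sym (⊕-assoc (φ² q) (-[1+ 0 ] , + 1) (step N))))
      (full²-N (q ⊕ step E) b (subst (Full w″) (sym (⊕-assoc q (step E) (step N))) c)))
    (subst (Full w) (trans (φ²-⊕ q (+ 1) (+ 0)) (sym (⊕-assoc (φ² q) (-[1+ 0 ] , + 1) (+ 1 , + 1)))) (full²-vertex (q ⊕ step E) b))
    where
    move² : ∀ v → φ² (q ⊕ step E) ⊕ v ≡ φ² q ⊕ ((+ 0 , + 2) ⊕ v)
    move² v = trans (cong (_⊕ v) (φ²-⊕ q (+ 1) (+ 0))) (⊕-assoc (φ² q) (+ 0 , + 2) v)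

  block-from-corner-N : ∀ q → Full w″ q → Full w″ (q ⊕ step N) → Full w″ (q ⊕ (+ 1 , + 1)) →
    Block w 1 (φ² q ⊕ (-[1+ 1 ] , + 0))
  block-from-corner-N q a b c = unit-block w (φ² q ⊕ (-[1+ 1 ] , + 0))
    (subst (Full w) (φ²-⊕ q (+ 0) (+ 1)) (full²-vertex (q ⊕ step N) b))
    (subst (Full w) (sym (⊕-assoc (φ² q) (-[1+ 1 ] , + 0) (step E))) (full²-N q a b))
    (subst (Full w) (trans (move² (step N)) (sym (⊕-assoc (φ² q) (-[1+ 1 ] , + 0) (step N))))
      (full²-E (q ⊕ step N) b (subst (Full w″) (sym (⊕-assoc q (step N) (step E))) c)))
    (subst (Full w) (sym (⊕-assoc (φ² q) (-[1+ 1 ] , + 0) (+ 1 , + 1))) (full²-centre q a c))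
    where
    move² : ∀ v → φ² (q ⊕ step N) ⊕ v ≡ φ² q ⊕ ((-[1+ 1 ] , + 0) ⊕ v)
    move² v = trans (cong (_⊕ v) (φ²-⊕ q (+ 0) (+ 1))) (⊕-assoc (φ² q) (-[1+ 1 ] , + 0) v)

  private module R″ = Refinement w″

  -- One refinement makes the adjacent pair a diagonal of a unit square, and `full-pair` adds a
  -- third corner.
  block-from-pair : ∀ q → Full (coarsen w″) q → Full (coarsen w″) (q ⊕ step E) → ∃[ p ] Block w 1 p
  block-from-pair q f g = [ (λ h → φ² u ⊕ (-[1+ 0 ] , + 1) , block-from-corner-E u a h c)
                          , (λ h → φ² u ⊕ (-[1+ 1 ] , + 0) , block-from-corner-N u a h c) ]′ (R″.full-pair q f g)
    where
    u = R″.φ q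
    a : Full w″ u
    a = R″.full-vertex f
    c : Full w″ (u ⊕ (+ 1 , + 1))
    c = subst (Full w″) (R″.φ-⊕ q (step E)) (R″.full-vertex g)

-- A search for two adjacent full vertices

_==ᶻ_ : ℤ → ℤ → Bool
(+ m)    ==ᶻ (+ n)    = m ℕ.≡ᵇ n
-[1+ m ] ==ᶻ -[1+ n ] = m ℕ.≡ᵇ n
_        ==ᶻ _        = false

_==ᵖ_ : Point → Point → Bool
(a , b) ==ᵖ (a′ , b′) = (a ==ᶻ a′) ∧ (b ==ᶻ b′)

_==ᵈ_ : Dir → Dir → Bool
E ==ᵈ E = true
N ==ᵈ N = true
W ==ᵈ W = true
S ==ᵈ S = true
_ ==ᵈ _ = false

half : ℤ → ℤ
half (+ n)    = + ℕ.⌊ n /2⌋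
half -[1+ n ] = - (+ ℕ.⌊ suc n /2⌋)

-- Inverse to M on its image only.
M⁻¹ : Point → Point
M⁻¹ (x , y) = half (x + y) , half (y - x)

-- covers? ss δ₀ decides whether a half-edge is covered by the unit edge at the origin in
-- direction δ₀ after refinements with the colours ss (the last refinement first).
mutual
  covers? : ∀ {n} → Vec Sign n → Dir → Point → Dir → Bool
  covers? []       δ₀ q δ = origin? δ₀ q δ ∨ origin? δ₀ (q ⊕ step δ) (opp δ)
  covers? (s ∷ ss) δ₀ q δ = via? s ss δ₀ q δ ∨ via? s ss δ₀ (q ⊕ step δ) (opp δ)

  origin? : Dir → Point → Dir → Bool
  origin? δ₀ q δ = (q ==ᵖ (+ 0 , + 0)) ∧ (δ ==ᵈ δ₀)

  via? : ∀ {n} → Sign → Vec Sign n → Dir → Point → Dir → Bool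
  via? s ss δ₀ q δ = (M (M⁻¹ q) ==ᵖ q) ∧ covers? ss δ₀ (M⁻¹ q) (coarseDir (colour s (M⁻¹ q)) δ)

full? : ∀ {n} → Vec Sign n → Dir → Point → Bool
full? ss δ₀ q = covers? ss δ₀ q E ∧ (covers? ss δ₀ q N ∧ (covers? ss δ₀ q W ∧ covers? ss δ₀ q S))

pair? : ∀ {n} → Vec Sign n → Dir → Point → Bool
pair? ss δ₀ q = full? ss δ₀ q ∧ full? ss δ₀ (q ⊕ step E)

-- The box [-6,5] × [-5,5] is the smallest one that always contains a suitable pair.
pairAt? : Dir → Vec Sign 5 → ℕ → ℕ → Bool
pairAt? δ₀ ss x y = pair? ss δ₀ (+ x - + 6 , + y - + 5)

pairInBox? : Dir → Vec Sign 5 → Bool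
pairInBox? δ₀ ss = any (λ x → any (pairAt? δ₀ ss x) (upTo 11)) (upTo 12)

allVecs : ∀ n → (Vec Sign n → Bool) → Bool
allVecs zero    f = f []
allVecs (suc n) f = allVecs n (f ∘ (plus ∷_)) ∧ allVecs n (f ∘ (minus ∷_))

T-∧⁻ : ∀ x y → T (x ∧ y) → T x × T y
T-∧⁻ x y = Equivalence.to (Boolₚ.T-∧ {x} {y})

T-∨⁻ : ∀ x {y} → T (x ∨ y) → T x ⊎ T y
T-∨⁻ x {y} = Equivalence.to (Boolₚ.T-∨ {x} {y})

allVecs-sound : ∀ n f → T (allVecs n f) → ∀ ss → T (f ss)
allVecs-sound zero    f t []           = t
allVecs-sound (suc n) f t (plus  ∷ ss) = allVecs-sound n _ (proj₁ (T-∧⁻ (allVecs n (f ∘ (plus ∷_))) _ t)) ss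
allVecs-sound (suc n) f t (minus ∷ ss) = allVecs-sound n _ (proj₂ (T-∧⁻ (allVecs n (f ∘ (plus ∷_))) _ t)) ss

-- Proved by evaluation: for each direction, 32 colour patterns, each searched over a box of 132
-- points.
pairInBox-always : ∀ δ₀ → T (allVecs 5 (pairInBox? δ₀))
pairInBox-always E = tt
pairInBox-always N = tt
pairInBox-always W = tt
pairInBox-always S = tt

abstract
  pair-exists : ∀ δ₀ ss → ∃[ q ] T (pair? {5} ss δ₀ q)
  pair-exists δ₀ ss =
    let x , t  = Any.satisfied (Anyₚ.any⁻ (λ x → any (pairAt? δ₀ ss x) (upTo 11)) (upTo 12)
                   (allVecs-sound 5 (pairInBox? δ₀) (pairInBox-always δ₀) ss))
        y , t′ = Any.satisfied (Anyₚ.any⁻ (pairAt? δ₀ ss x) (upTo 11) t)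
    in (+ x - + 6 , + y - + 5) , t′

==ᶻ-sound : ∀ a b → T (a ==ᶻ b) → a ≡ b
==ᶻ-sound (+ m)    (+ n)    t = cong +_ (ℕₚ.≡ᵇ⇒≡ m n t)
==ᶻ-sound -[1+ m ] -[1+ n ] t = cong -[1+_] (ℕₚ.≡ᵇ⇒≡ m n t)

==ᵖ-sound : ∀ p q → T (p ==ᵖ q) → p ≡ q
==ᵖ-sound (a , b) (c , d) t =
  let t₁ , t₂ = T-∧⁻ (a ==ᶻ c) (b ==ᶻ d) t in ,-cong (==ᶻ-sound a c t₁) (==ᶻ-sound b d t₂)

==ᵈ-sound : ∀ d e → T (d ==ᵈ e) → d ≡ e
==ᵈ-sound E E t = refl
==ᵈ-sound N N t = refl
==ᵈ-sound W W t = refl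
==ᵈ-sound S S t = refl

module _ (w : Walk) where
  open Coarsened (coarsened w)

  reversed : ∀ v q δ → Covered w ((q ⊕ step δ) ⊕ v) (opp δ) → Covered w (q ⊕ v) δ
  reversed v q δ c = Covered-at
    (trans (cong (_⊕ step (opp δ)) (trans (⊕-assoc q (step δ) v)
      (trans (cong (q ⊕_) (⊕-comm (step δ) v)) (sym (⊕-assoc q v (step δ)))))) (there-and-back (q ⊕ v) δ))
    (opp-involutive δ) (Covered-reverse c)

  origin-sound : ∀ q δ → T (origin? (heading w (+ 0)) q δ) → Covered w (q ⊕ pos w (+ 0)) δ
  origin-sound q δ t =
    let t₁ , t₂ = T-∧⁻ (q ==ᵖ (+ 0 , + 0)) (δ ==ᵈ heading w (+ 0)) t
    in covered (+ 0) (inj₁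
      ( trans (sym (⊕-identityʳ _)) (trans (⊕-comm (pos w (+ 0)) (+ 0 , + 0))
          (cong (_⊕ pos w (+ 0)) (sym (==ᵖ-sound q _ t₁))))
      , sym (==ᵈ-sound δ _ t₂)))

  -- The search places its starting edge at the origin. Translating the coarse points by `v`
  -- replaces the colour `σ` at the origin by `colour σ v` and moves the fine points by
  -- `M v ⊕ origin`.
  via-sound : ∀ {n} (ss : Vec Sign n) δ₀ v → (∀ q δ → T (covers? ss δ₀ q δ) → Covered coarse (q ⊕ v) δ) →
    ∀ q δ → T (via? (colour σ v) ss δ₀ q δ) → Covered w (q ⊕ (M v ⊕ origin)) δ
  via-sound ss δ₀ v sound q δ t =
    let t₁ , t₂ = T-∧⁻ (M (M⁻¹ q) ==ᵖ q) _ t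
        p = M⁻¹ q
        s = colour (colour σ v) p
    in Covered-at
      (trans (cong (_⊕ origin) (M-⊕ p v)) (trans (⊕-assoc (M p) (M v) origin)
        (cong (_⊕ (M v ⊕ origin)) (==ᵖ-sound (M p) q t₁))))
      (trans (cong (λ z → fineDir z (coarseDir s δ)) (colour-⊕ σ p v)) (fine-coarse s δ))
      (refine (p ⊕ v) (coarseDir s δ) (sound p (coarseDir s δ) t₂))

covers-sound : ∀ n w → ∃[ ss ] ∃[ δ₀ ] ∃[ v ] (∀ q δ → T (covers? {n} ss δ₀ q δ) → Covered w (q ⊕ v) δ)
covers-sound zero w = [] , heading w (+ 0) , pos w (+ 0) , λ q δ t →
  [ origin-sound w q δ , (λ t → reversed w _ q δ (origin-sound w (q ⊕ step δ) (opp δ) t)) ]′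
    (T-∨⁻ (origin? (heading w (+ 0)) q δ) t)
covers-sound (suc n) w =
  let open Coarsened (coarsened w)
      ss , δ₀ , v , sound = covers-sound n coarse
      via = via-sound w ss δ₀ v sound
  in colour σ v ∷ ss , δ₀ , M v ⊕ origin , λ q δ t →
    [ via q δ , (λ t → reversed w _ q δ (via (q ⊕ step δ) (opp δ) t)) ]′
      (T-∨⁻ (via? (colour σ v) ss δ₀ q δ) t)

full-pair-exists : ∀ w → ∃[ q ] (Full w q × Full w (q ⊕ step E))
full-pair-exists w =
  let ss , δ₀ , v , sound = covers-sound 5 w
      q , t               = pair-exists δ₀ ss
      t₁ , t₂             = T-∧⁻ (full? ss δ₀ q) (full? ss δ₀ (q ⊕ step E)) t
      full : ∀ q → T (full? ss δ₀ q) → Full w (q ⊕ v)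
      full q t =
        let tE , t′  = T-∧⁻ (covers? ss δ₀ q E) _ t
            tN , t″  = T-∧⁻ (covers? ss δ₀ q N) _ t′
            tW , tS  = T-∧⁻ (covers? ss δ₀ q W) _ t″
        in ∀-dir (sound q E tE) (sound q N tN) (sound q W tW) (sound q S tS)
  in q ⊕ v , full q t₁ , subst (Full w)
       (trans (⊕-assoc q (step E) v) (trans (cong (q ⊕_) (⊕-comm (step E) v)) (sym (⊕-assoc q v (step E)))))
       (full (q ⊕ step E) t₂)

-- The seed is found in a sufficiently coarse walk: each doubling costs two coarsenings, and the
-- unit block costs three more before the search.
large-block : ∀ n w → ∃[ q ] Block w (2 ℕ.^ n) q
large-block zero    w =
  let q , f , g = full-pair-exists (coarsen (coarsen (coarsen w))) in block-from-pair w q f g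
large-block (suc n) w =
  let q , b = large-block n (coarsen (coarsen w)) in subst (λ m → ∃[ p ] Block w m p) (double≡2* (2 ℕ.^ n))
       (Refinement².φ² w q ⊕ (- (+ 2 * + (2 ℕ.^ n)) , + 0) , block-double w (2 ℕ.^ n) q b)

-- Recurrence with reversed headings

rot-opp : ∀ s d → rot s (opp d) ≡ opp (rot s d)
rot-opp = ∀-sign (∀-dir refl refl refl refl) (∀-dir refl refl refl refl)

fineDir-opp : ∀ s d → fineDir s (opp d) ≡ opp (fineDir s d)
fineDir-opp = ∀-sign (∀-dir refl refl refl refl) (∀-dir refl refl refl refl)

rot-twice : ∀ s d → rot s (rot s d) ≡ opp d
rot-twice = ∀-sign (∀-dir refl refl refl refl) (∀-dir refl refl refl refl)

rot-neg : ∀ s d → rot (neg s) (rot s d) ≡ d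
rot-neg = ∀-sign (∀-dir refl refl refl refl) (∀-dir refl refl refl refl)

equal-or-opposite : ∀ s t → t ≡ s ⊎ t ≡ neg s
equal-or-opposite plus  plus  = inj₁ refl
equal-or-opposite plus  minus = inj₂ refl
equal-or-opposite minus plus  = inj₂ refl
equal-or-opposite minus minus = inj₁ refl

heading+2 : ∀ w y → heading w (y + + 2) ≡ opp (heading w y) ⊎
  (heading w (y + + 2) ≡ heading w y × turns w (y + + 1) ≡ neg (turns w y))
heading+2 w y = [ (λ e → inj₁ (trans two (trans (cong (λ z → rot z (rot s d)) e) (rot-twice s d))))
                , (λ e → inj₂ (trans two (trans (cong (λ z → rot z (rot s d)) e) (rot-neg s d)) , e)) ]′
                (equal-or-opposite s (turns w (y + + 1)))
  where
  s = turns w y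
  d = heading w y
  two : heading w (y + + 2) ≡ rot (turns w (y + + 1)) (rot s d)
  two = trans (cong (heading w) (sym (ℤₚ.+-assoc y (+ 1) (+ 1))))
    (trans (rotate w (y + + 1)) (cong (rot (turns w (y + + 1))) (rotate w y)))

parallel : ∀ w x t → heading w (x + + 2 * t) ≡ heading w x ⊎ heading w (x + + 2 * t) ≡ opp (heading w x)
parallel w x = ℤ-induction _ (inj₁ (cong (heading w) (ℤₚ.+-identityʳ x))) up down
  where
  H : ℤ → Dir
  H t = heading w (x + + 2 * t)
  idx : ∀ x t → x + + 2 * (t + + 1) ≡ x + + 2 * t + + 2
  idx = solve-∀
  next : ∀ t → H (t + + 1) ≡ H t ⊎ H (t + + 1) ≡ opp (H t)
  next t = [ (λ e → inj₂ (trans (cong (heading w) (idx x t)) e))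
           , (λ e → inj₁ (trans (cong (heading w) (idx x t)) (proj₁ e))) ]′ (heading+2 w (x + + 2 * t))
  combine : ∀ {a b c : Dir} → a ≡ b ⊎ a ≡ opp b → b ≡ c ⊎ b ≡ opp c → a ≡ c ⊎ a ≡ opp c
  combine (inj₁ refl) q = q
  combine (inj₂ refl) (inj₁ refl) = inj₂ refl
  combine (inj₂ refl) (inj₂ refl) = inj₁ (opp-involutive _)
  flip : ∀ {a b : Dir} → a ≡ b ⊎ a ≡ opp b → b ≡ a ⊎ b ≡ opp a
  flip (inj₁ refl) = inj₁ refl
  flip (inj₂ refl) = inj₂ (sym (opp-involutive _))
  up : ∀ t → H t ≡ heading w x ⊎ H t ≡ opp (heading w x) → H (t + + 1) ≡ heading w x ⊎ H (t + + 1) ≡ opp (heading w x)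
  up t p = combine (next t) p
  down : ∀ t → H (t + + 1) ≡ heading w x ⊎ H (t + + 1) ≡ opp (heading w x) → H t ≡ heading w x ⊎ H t ≡ opp (heading w x)
  down t p = combine (flip (next t)) p

-- Two equal consecutive turns reverse the heading, and two opposite ones restore it. Thus the first
-- pair of equal turns among four pairs from `x` on is enough.
reversal₀ : ∀ w x → ∃[ u ] (heading w (x + + 2 * u) ≡ opp (heading w x))
reversal₀ w x = [ (λ r → r) , (λ p → ⊥-elim (impossible (proj₂ p))) ]′ (search 4)
  where
  a = turns w
  D = derivation (folds w)
  idx : ∀ x n → x + + 2 * (+ 1 + n) ≡ x + + 2 * n + + 2
  idx = solve-∀
  search : ∀ n → (∃[ u ] (heading w (x + + 2 * u) ≡ opp (heading w x))) ⊎
    (heading w (x + + 2 * + n) ≡ heading w x × (∀ i → i ℕ.< n → a (x + + 2 * + i + + 1) ≡ neg (a (x + + 2 * + i))))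
  search zero    = inj₂ (cong (heading w) (ℤₚ.+-identityʳ x) , λ i ())
  search (suc n) with search n
  ... | inj₁ r = inj₁ r
  ... | inj₂ (e , alt) with heading+2 w (x + + 2 * + n)
  ...   | inj₁ o = inj₁ (+ suc n , trans (cong (heading w) (idx x (+ n))) (trans o (cong opp e)))
  ...   | inj₂ (e′ , o) = inj₂ (trans (cong (heading w) (idx x (+ n))) (trans e′ e) , alt′)
    where
    alt′ : ∀ i → i ℕ.< suc n → a (x + + 2 * + i + + 1) ≡ neg (a (x + + 2 * + i))
    alt′ i p with ℕₚ.m≤n⇒m<n∨m≡n (ℕₚ.≤-pred p)
    ... | inj₁ q = alt i q
    ... | inj₂ refl = o
  swap : ∀ x i → x + + 2 * i + + 1 ≡ x + + 1 + + 2 * i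
  swap = solve-∀
  -- If all four pairs of turns had opposite signs, both parities would alternate.
  impossible : (∀ i → i ℕ.< 4 → a (x + + 2 * + i + + 1) ≡ neg (a (x + + 2 * + i))) → ⊥
  impossible alt with parity-from (base D) x
  ... | k , inj₁ e = let k′ , e′ = alternating₄-base D (x + + 1) odd
                     in 2k≢2l+1 (base D) k′ k (trans (sym e′) (cong (_+ + 1) e))
    where
    odd : Alternating₄ a (x + + 1)
    odd i p = trans (cong a (sym (swap x (+ suc i)))) (trans (alt (suc i) (s≤s p))
      (cong neg (trans (subst (Alternating₄ a) (sym e) (base-alternating₄ D k) i p)
        (trans (sym (alt i (ℕₚ.m≤n⇒m≤1+n p))) (cong a (swap x (+ i)))))))
  ... | k , inj₂ e = let k′ , e′ = alternating₄-base D x even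
                     in 2k≢2l+1 (base D) k′ k (trans (sym e′) e)
    where
    next : ∀ h k → h + + 2 * k + + 1 + + 1 ≡ h + + 2 * (k + + 1)
    next = solve-∀
    cancel : ∀ {s t} → s ≡ neg t → t ≡ neg s
    cancel {t = t} refl = sym (neg-involutive t)
    even : Alternating₄ a x
    even i p = trans (cancel (alt (suc i) (s≤s p))) (cong neg (trans (cong a (swap x (+ suc i)))
      (trans (subst (Alternating₄ a) (sym (trans (cong (_+ + 1) e) (next (base D) k))) (base-alternating₄ D (k + + 1)) i p)
      (trans (cong neg (trans (cong a (sym (swap x (+ i)))) (alt i (ℕₚ.m≤n⇒m≤1+n p)))) (neg-involutive _)))))

Reversal : Walk → ℕ → ℤ → Set
Reversal w n x = ∃[ u ] (∀ m → m ℕ.≤ n → heading w (x + + m + + 2 * u) ≡ opp (heading w (x + + m)))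

module _ (w : Walk) where
  open Coarsened (coarsened w)

  heading-turn : ∀ {x y} → turns w y ≡ turns w x → heading w y ≡ opp (heading w x) →
    heading w (y + + 1) ≡ opp (heading w (x + + 1))
  heading-turn {x} {y} e f = trans (rotate w y) (trans (cong₂ rot e f)
    (trans (rot-opp (turns w x) (heading w x)) (cong opp (sym (rotate w x)))))

  -- An even coarse shift preserves the alternating sign, so both fine edges of the coarse edge are
  -- reversed along with it.
  reversal-refine : ∀ k q → heading coarse (k + + 2 * q) ≡ opp (heading coarse k) →
    heading w (base D + + 2 * k + + 2 * (+ 2 * q)) ≡ opp (heading w (base D + + 2 * k)) ×
    heading w (base D + + 2 * k + + 1 + + 2 * (+ 2 * q)) ≡ opp (heading w (base D + + 2 * k + + 1))
  reversal-refine k q e = subst (λ z → heading w z ≡ opp (heading w x)) (idx (base D) k q) first ,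
    subst (λ z → heading w z ≡ opp (heading w (x + + 1))) (idx′ (base D) k q) (heading-turn (signs-even D k q) first)
    where
    x = base D + + 2 * k
    idx : ∀ h k q → h + + 2 * (k + + 2 * q) ≡ h + + 2 * k + + 2 * (+ 2 * q)
    idx = solve-∀
    idx′ : ∀ h k q → h + + 2 * (k + + 2 * q) + + 1 ≡ h + + 2 * k + + 1 + + 2 * (+ 2 * q)
    idx′ = solve-∀
    first : heading w (base D + + 2 * (k + + 2 * q)) ≡ opp (heading w x)
    first = trans (heading-fine (k + + 2 * q)) (trans (cong₂ fineDir (signs-even D k q) e)
      (trans (fineDir-opp (turns w x) (heading coarse k)) (cong opp (sym (heading-fine k)))))

  reversal-from : ∀ x u → turns w (x + + 2 * u) ≡ turns w x → heading w (x + + 2 * u) ≡ opp (heading w x) → Reversal w 1 x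
  reversal-from x u e f = u , go
    where
    idx : ∀ x u → x + + 2 * u + + 1 ≡ x + + 1 + + 2 * u
    idx = solve-∀
    go : ∀ m → m ℕ.≤ 1 → heading w (x + + m + + 2 * u) ≡ opp (heading w (x + + m))
    go 0 _ = subst (λ z → heading w (z + + 2 * u) ≡ opp (heading w z)) (sym (ℤₚ.+-identityʳ x)) f
    go 1 _ = subst (λ z → heading w z ≡ opp (heading w (x + + 1))) (idx x u) (heading-turn e f)
    go (suc (suc _)) (s≤s ())

-- This is the start of the doubling, which could not leave length 0. Besides the heading at `x`,
-- the turn there has to recur; at a base place the coarse walk provides this, and the other parity
-- needs a coarse place with the same turn.
reversal₁ : ∀ w x → Reversal w 1 x
reversal₁ w x with parity-from (base (Coarsened.D (coarsened w))) x
... | k , inj₁ refl =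
  let open Coarsened (coarsened w)
      q , e = reversal₀ coarse k
      idx = solveIdx (base D) k q
  in reversal-from w (base D + + 2 * k) (+ 2 * q)
       (trans (cong (turns w) idx) (signs-even D k q)) (proj₁ (reversal-refine w k q e))
  where
  solveIdx : ∀ h k q → h + + 2 * k + + 2 * (+ 2 * q) ≡ h + + 2 * (k + + 2 * q)
  solveIdx = solve-∀
... | k , inj₂ refl = choose (parallel w x (κ - k))
  where
  open Coarsened (coarsened w)
  open Coarsened (coarsened coarse) using () renaming (D to D′)
  -- The base places of the coarse sequence alternate, so one of two consecutive ones carries the
  -- turn wanted.
  find : ∃[ l ] (turns coarse (base D′ + + 2 * l) ≡ turns coarse k)
  find with equal-or-opposite (turns coarse (base D′ + + 2 * + 0)) (turns coarse k)
  ... | inj₁ e = + 0 , sym e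
  ... | inj₂ e = + 1 , trans (alternating D′ (+ 0)) (sym e)
  l = proj₁ find
  κ = base D′ + + 2 * l
  idx : ∀ h k κ → h + + 2 * k + + 1 + + 2 * (κ - k) ≡ h + + 2 * κ + + 1
  idx = solve-∀
  same-turn : ∀ κ → turns coarse κ ≡ turns coarse k → turns w (x + + 2 * (κ - k)) ≡ turns w x
  same-turn κ e = trans (cong (turns w) (idx (base D) k κ)) (trans (sym (turns-coarse κ)) (trans e (turns-coarse k)))
  q = proj₁ (reversal₀ (coarsen coarse) l)
  κ′ = κ + + 2 * (+ 2 * q)
  κ′-turn : turns coarse κ′ ≡ turns coarse κ
  κ′-turn = trans (cong (turns coarse) (idx′ (base D′) l q)) (signs-even D′ l q)
    where
    idx′ : ∀ h l q → h + + 2 * l + + 2 * (+ 2 * q) ≡ h + + 2 * (l + + 2 * q)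
    idx′ = solve-∀
  -- A reversal two levels up is refined twice. It keeps the turn at `κ` and reverses the heading,
  -- so one of `κ` and `κ′` has the heading opposite to that at `x`.
  κ′-reversed : heading w (x + + 2 * (κ′ - k)) ≡ opp (heading w (x + + 2 * (κ - k)))
  κ′-reversed = subst₂ (λ y z → heading w y ≡ opp (heading w z)) (idx″ (base D) k κ q) (sym (idx (base D) k κ))
    (proj₂ (reversal-refine w κ (+ 2 * q)
      (proj₁ (reversal-refine coarse l q (proj₂ (reversal₀ (coarsen coarse) l))))))
    where
    idx″ : ∀ h k κ q → h + + 2 * κ + + 1 + + 2 * (+ 2 * (+ 2 * q)) ≡ h + + 2 * k + + 1 + + 2 * (κ + + 2 * (+ 2 * q) - k)
    idx″ = solve-∀
  choose : heading w (x + + 2 * (κ - k)) ≡ heading w x ⊎ heading w (x + + 2 * (κ - k)) ≡ opp (heading w x) → Reversal w 1 x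
  choose (inj₂ e) = reversal-from w x (κ - k) (same-turn κ (proj₂ find)) e
  choose (inj₁ e) = reversal-from w x (κ′ - k) (same-turn κ′ (trans κ′-turn (proj₂ find))) (trans κ′-reversed (cong opp e))

-- The `n + 1` reversed coarse edges give `2 * n + 2` reversed fine edges. These contain `2 * n + 1`
-- consecutive ones from `x` on, whether `x` is the first or the second edge of its pair.
reversal-double : ∀ n → (∀ w x → Reversal w n x) → ∀ w x → Reversal w (double n) x
reversal-double n rev w x with parity-from (base (Coarsened.D (coarsened w))) x
... | k , par = + 2 * u , go par
  where
  open Coarsened (coarsened w)
  u = proj₁ (rev coarse k)
  Rev : ℤ → Set
  Rev z = heading w (z + + 2 * (+ 2 * u)) ≡ opp (heading w z)
  even : ∀ j → j ℕ.≤ n → Rev (base D + + 2 * (k + + j))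
  even j p = proj₁ (reversal-refine w (k + + j) u (proj₂ (rev coarse k) j p))
  odd : ∀ j → j ℕ.≤ n → Rev (base D + + 2 * (k + + j) + + 1)
  odd j p = proj₂ (reversal-refine w (k + + j) u (proj₂ (rev coarse k) j p))
  half-≤ : ∀ j → double j ℕ.≤ double n → j ℕ.≤ n
  half-≤ j p = double-cancel-≤ j n (ℕₚ.m≤n⇒m≤1+n p)
  half-< : ∀ j → suc (double j) ℕ.≤ double n → suc j ℕ.≤ n
  half-< j p = double-cancel-≤ (suc j) n (s≤s p)
  i₀₀ : ∀ h k j → h + + 2 * (k + j) ≡ h + + 2 * k + + 2 * j
  i₀₀ = solve-∀
  i₀₁ : ∀ h k j → h + + 2 * (k + j) + + 1 ≡ h + + 2 * k + (+ 1 + + 2 * j)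
  i₀₁ = solve-∀
  i₁₀ : ∀ h k j → h + + 2 * (k + j) + + 1 ≡ h + + 2 * k + + 1 + + 2 * j
  i₁₀ = solve-∀
  i₁₁ : ∀ h k j → h + + 2 * (k + (+ 1 + j)) ≡ h + + 2 * k + + 1 + (+ 1 + + 2 * j)
  i₁₁ = solve-∀
  go : (x ≡ base D + + 2 * k ⊎ x ≡ base D + + 2 * k + + 1) → ∀ m → m ℕ.≤ double n → Rev (x + + m)
  go par m p with ℕ-parity m
  go (inj₁ refl) m p | j , inj₁ refl =
    subst Rev (trans (i₀₀ (base D) k (+ j)) (cong (λ z → base D + + 2 * k + z) (sym (+double j)))) (even j (half-≤ j p))
  go (inj₁ refl) m p | j , inj₂ refl =
    subst Rev (trans (i₀₁ (base D) k (+ j)) (cong (λ z → base D + + 2 * k + (+ 1 + z)) (sym (+double j)))) (odd j (ℕₚ.<⇒≤ (half-< j p)))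
  go (inj₂ refl) m p | j , inj₁ refl =
    subst Rev (trans (i₁₀ (base D) k (+ j)) (cong (λ z → base D + + 2 * k + + 1 + z) (sym (+double j)))) (odd j (half-≤ j p))
  go (inj₂ refl) m p | j , inj₂ refl =
    subst Rev (trans (i₁₁ (base D) k (+ j)) (cong (λ z → base D + + 2 * k + + 1 + (+ 1 + z)) (sym (+double j)))) (even (suc j) (half-< j p))

reversal-2^ : ∀ n w x → Reversal w (2 ℕ.^ n) x
reversal-2^ zero    = reversal₁
reversal-2^ (suc n) w x =
  subst (λ m → Reversal w m x) (double≡2* (2 ℕ.^ n)) (reversal-double (2 ℕ.^ n) (reversal-2^ n) w x)

reversal : ∀ w R → ∃[ u ] (∀ x → ∣ x ∣ ℕ.≤ R → heading w (x + u) ≡ opp (heading w x))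
reversal w R =
  let u , rev = reversal-2^ (R ℕ.+ R) w (- (+ R))
  in + 2 * u , λ x p → let n , e , q = fromCentre x R p
       in subst (λ z → heading w (z + + 2 * u) ≡ opp (heading w z)) (trans (ℤₚ.+-comm (- (+ R)) (+ n)) (sym e))
            (rev n (ℕₚ.≤-trans q (ℕₚ.≤-trans (ℕₚ.+-monoˡ-≤ R p) (ℕₚ.<⇒≤ (n<2^n (R ℕ.+ R))))))

-- Curves and coverings

module _ (P : ℤ → Set) (R : ℕ) (up : ∀ x → ∣ x ∣ ℕ.≤ R → P x → P (x + + 1)) (down : ∀ x → ∣ x ∣ ℕ.≤ R → P (x + + 1) → P x) where

  spread-from-0 : P (+ 0) → ∀ x → ∣ x ∣ ℕ.≤ R → P x
  spread-from-0 p₀ (+ zero) _ = p₀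
  spread-from-0 p₀ (+ suc n) le =
    subst P (cong +_ (ℕₚ.+-comm n 1)) (up (+ n) (ℕₚ.<⇒≤ le) (spread-from-0 p₀ (+ n) (ℕₚ.<⇒≤ le)))
  spread-from-0 p₀ -[1+ zero ] le = down -[1+ 0 ] le p₀
  spread-from-0 p₀ -[1+ suc n ] le = down -[1+ suc n ] le (spread-from-0 p₀ -[1+ n ] (ℕₚ.<⇒≤ le))

  spread-to-0 : ∀ x → ∣ x ∣ ℕ.≤ R → P x → P (+ 0)
  spread-to-0 (+ zero) _ p = p
  spread-to-0 (+ suc n) le p = spread-to-0 (+ n) (ℕₚ.<⇒≤ le)
    (down (+ n) (ℕₚ.<⇒≤ le) (subst P (cong +_ (ℕₚ.+-comm 1 n)) p))
  spread-to-0 -[1+ zero ] le p = up -[1+ 0 ] le p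
  spread-to-0 -[1+ suc n ] le p = spread-to-0 -[1+ n ] (ℕₚ.<⇒≤ le) (up -[1+ suc n ] le p)

-- `turn` also gives `minus` on parallel directions; perpendicularity excludes these.
turn-rot : ∀ d e → (orient d ≡ hor × orient e ≡ ver) ⊎ (orient d ≡ ver × orient e ≡ hor) → e ≡ rot (turn d e) d
turn-rot E E (inj₁ (_ , ()))
turn-rot E E (inj₂ (() , _))
turn-rot E N _ = refl
turn-rot E W (inj₁ (_ , ()))
turn-rot E W (inj₂ (() , _))
turn-rot E S _ = refl
turn-rot N E _ = refl
turn-rot N N (inj₁ (() , _))
turn-rot N N (inj₂ (_ , ()))
turn-rot N W _ = refl
turn-rot N S (inj₁ (() , _))
turn-rot N S (inj₂ (_ , ()))
turn-rot W E (inj₁ (_ , ()))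
turn-rot W E (inj₂ (() , _))
turn-rot W N _ = refl
turn-rot W W (inj₁ (_ , ()))
turn-rot W W (inj₂ (() , _))
turn-rot W S _ = refl
turn-rot S E _ = refl
turn-rot S N (inj₁ (() , _))
turn-rot S N (inj₂ (_ , ()))
turn-rot S W _ = refl
turn-rot S S (inj₁ (() , _))
turn-rot S S (inj₂ (_ , ()))

curveWalk : ∀ C → IsCompleteCurve C → CompleteFoldingSeq (assocSeq C) → Walk
curveWalk C complete folding = record
  { turns = assocSeq C ; pos = λ i → start (C i) ; heading = λ i → dir (C i)
  ; advance = λ i → sym (connected i) ; rotate = λ i → turn-rot _ _ (perpendicular i) ; folds = folding }
  where open IsCompleteCurve complete

walk : (𝒞 : Covering) → Index 𝒞 → Walk
walk 𝒞 i = curveWalk (curve 𝒞 i) (complete 𝒞 i) (folding 𝒞 i)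

support-reverse : ∀ q δ → support (seg (q ⊕ step δ) (opp δ)) ≡ support (seg q δ)
support-reverse q E = cong (λ p → edge p hor) (there-and-back q E)
support-reverse q N = cong (λ p → edge p ver) (there-and-back q N)
support-reverse q W = refl
support-reverse q S = refl

covered-support : ∀ 𝒞 i {q δ} → Covered (walk 𝒞 i) q δ → ∃[ k ] (support (curve 𝒞 i k) ≡ support (seg q δ))
covered-support 𝒞 i         (covered k (inj₁ (e , f))) = k , cong₂ (λ p d → support (seg p d)) e f
covered-support 𝒞 i {q} {δ} (covered k (inj₂ (e , f))) = k , trans (cong₂ (λ p d → support (seg p d)) e f) (support-reverse q δ)

same-support : ∀ 𝒞 {i k i′ k′} → support (curve 𝒞 i k) ≡ support (curve 𝒞 i′ k′) → Σ (i′ ≡ i) (λ _ → k′ ≡ k)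
same-support 𝒞 {i} {k} {i′} {k′} e with covers 𝒞 (support (curve 𝒞 i′ k′))
... | i₀ , k₀ , _ , unique with unique i k e | unique i′ k′ refl
...   | refl , refl | refl , refl = refl , refl

square-≤ : ∀ x y r → sq x + sq y ℤ.≤ + r * + r → ∣ x ∣ ℕ.≤ r
square-≤ x y r le = ℕₚ.≮⇒≥ λ r<x → ℕₚ.<⇒≱ (ℕₚ.*-mono-< r<x r<x) (ℕₚ.≤-trans (ℕₚ.m≤m+n _ (∣ y ∣ ℕ.* ∣ y ∣)) le′)
  where
  sq-abs : ∀ x → sq x ≡ + (∣ x ∣ ℕ.* ∣ x ∣)
  sq-abs (+ n)    = sym (ℤₚ.pos-* n n)
  sq-abs -[1+ n ] = refl
  le′ : ∣ x ∣ ℕ.* ∣ x ∣ ℕ.+ ∣ y ∣ ℕ.* ∣ y ∣ ℕ.≤ r ℕ.* r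
  le′ = ℤₚ.drop‿+≤+ (subst₂ ℤ._≤_ (cong₂ _+_ (sq-abs x) (sq-abs y)) (sym (ℤₚ.pos-* r r)) le)

disk-in-box : ∀ q r p → InDiskP (q ⊕ (+ r , + r)) r p →
  ∃[ I ] ∃[ J ] (I ℕ.≤ r ℕ.+ r × J ℕ.≤ r ℕ.+ r × p ≡ q ⊕ (+ I , + J))
disk-in-box (qx , qy) r (px , py) inside =
  let bx = square-≤ (px - (qx + + r)) (py - (qy + + r)) r inside
      by = square-≤ (py - (qy + + r)) (px - (qx + + r)) r (subst (ℤ._≤ + r * + r) (ℤₚ.+-comm (sq (px - (qx + + r))) _) inside)
      I , ex , lx = fromCentre (px - (qx + + r)) r bx
      J , ey , ly = fromCentre (py - (qy + + r)) r by
  in I , J , ℕₚ.≤-trans lx (ℕₚ.+-monoˡ-≤ r bx) , ℕₚ.≤-trans ly (ℕₚ.+-monoˡ-≤ r by) ,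
     ,-cong (solved px qx (+ r) (+ I) ex) (solved py qy (+ r) (+ J) ey)
  where
  lem : ∀ p q r → p ≡ p - (q + r) + (q + r)
  lem = solve-∀
  lem′ : ∀ q r i → i - r + (q + r) ≡ q + i
  lem′ = solve-∀
  solved : ∀ p q r i → p - (q + r) ≡ i - r → p ≡ q + i
  solved p q r i e = trans (lem p q r) (trans (cong (_+ (q + r)) e) (lem′ q r i))

-- Each curve of the covering contains a full block as large as the disks in which every
-- finite pattern has to occur.
occurs-in-curve : ∀ 𝒞 → LocalIsoProperty 𝒞 → ∀ i F → All (IsDecoOf 𝒞) F →
  ∃[ v ] All (λ d → ∃[ k ] (transl v d ≡ decoAt (curve 𝒞 i) k)) F
occurs-in-curve 𝒞 lip i F decos with lip F decos
... | r , _ , occurs with large-block (r ℕ.+ r) (walk 𝒞 i)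
... | q , block with occurs (q ⊕ (+ r , + r))
... | v , all = v , All.map locate all
  where
  locate : ∀ {d} → IsDecoOf 𝒞 (transl v d) × InDisk (q ⊕ (+ r , + r)) r (transl v d) →
    ∃[ k ] (transl v d ≡ decoAt (curve 𝒞 i) k)
  locate {d} ((i′ , k′ , e) , inside , _) =
    let s = curve 𝒞 i′ k′
        I , J , I≤ , J≤ , pos≡ = disk-in-box q r (start s) (subst (InDiskP (q ⊕ (+ r , + r)) r) (cong (start ∘ dseg) e) inside)
        full = block I J (ℕₚ.≤-trans I≤ (ℕₚ.<⇒≤ (n<2^n _))) (ℕₚ.≤-trans J≤ (ℕₚ.<⇒≤ (n<2^n _)))
        -- Fullness yields a segment of curve `i` on the same edge. An edge supports only one
        -- segment of the covering, so the segment found in the disk lies on curve `i`, with the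
        -- same neighbours.
        k , e′ = covered-support 𝒞 i (full (dir s))
        i≡ , k≡ = same-support 𝒞 {i} {k} {i′} {k′} (trans e′ (cong (λ p → support (seg p (dir s))) (sym pos≡)))
    in k , trans e (cong₂ (λ i k → decoAt (curve 𝒞 i) k) i≡ k≡)

-- Matching long stretches of two curves

Matches : Curve → Curve → Set
Matches C D = ∀ R → ∃[ t ] (∀ x → ∣ x ∣ ℕ.≤ R → dir (D (x + t)) ≡ dir (C x))

support-transl : ∀ v s → support (translS v s) ≡ translE v (support s)
support-transl v (seg p E) = refl
support-transl v (seg p N) = refl
support-transl v (seg p W) = cong (λ p → edge p hor) (⊕-assoc v p (step W))
support-transl v (seg p S) = cong (λ p → edge p ver) (⊕-assoc v p (step S))

translE-⊕ : ∀ u v e → translE u (translE v e) ≡ translE (u ⊕ v) e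
translE-⊕ u v (edge p o) = cong (λ p → edge p o) (sym (⊕-assoc u v p))

translS-⊕ : ∀ u v s → translS u (translS v s) ≡ translS (u ⊕ v) s
translS-⊕ u v (seg p d) = cong (λ p → seg p d) (sym (⊕-assoc u v p))

transl-⊕ : ∀ u v d → transl u (transl v d) ≡ transl (u ⊕ v) d
transl-⊕ u v (deco a s b) rewrite translE-⊕ u v a | translS-⊕ u v s | translE-⊕ u v b = refl

-- A stretch of one curve is carried into the other covering and then, by recurrence, into the given
-- curve `D`. Its segments could a priori land at unrelated indices; the decorations keep them in
-- order.
locIso⇒matches : ∀ 𝒞 𝒟 → LocIsoInto 𝒞 𝒟 → LocalIsoProperty 𝒟 → ∀ i j → Matches (curve 𝒞 i) (curve 𝒟 j)
locIso⇒matches 𝒞 𝒟 into lip i j R = k₀ + + R , match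
  where
  C = curve 𝒞 i
  D = curve 𝒟 j
  f : ℕ → Deco
  f m = decoAt C (+ m - + R)
  len = suc (R ℕ.+ R)
  in𝒟 = into (applyUpTo f len) (Allₚ.applyUpTo⁺₂ f len (λ m → i , + m - + R , refl))
  v = proj₁ in𝒟
  inD = occurs-in-curve 𝒟 lip j (map (transl v) (applyUpTo f len)) (Allₚ.map⁺ (proj₂ in𝒟))
  τ = proj₁ inD ⊕ v
  at-index : ∀ {m} → m ℕ.< len → ∃[ k ] (transl τ (f m) ≡ decoAt D k)
  at-index {m} p = let k , e = Allₚ.applyUpTo⁻ f len (Allₚ.map⁻ (proj₂ inD)) p
                   in k , trans (sym (transl-⊕ (proj₁ inD) v (f m))) e
  k₀ = proj₁ (at-index (s≤s z≤n))
  -- The `nextE` of one image is the support of the next image, and distinct supports leave only one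
  -- index for it.
  consecutive : ∀ m (p : m ℕ.< len) (p′ : suc m ℕ.< len) → proj₁ (at-index p′) ≡ proj₁ (at-index p) + + 1
  consecutive m p p′ = IsCompleteCurve.distinct (complete 𝒟 j) _ _ (begin
    support (D (proj₁ (at-index p′)))              ≡⟨ cong (support ∘ dseg) (proj₂ (at-index p′)) ⟨
    support (translS τ (C (+ suc m - + R)))        ≡⟨ support-transl τ (C (+ suc m - + R)) ⟩
    translE τ (support (C (+ suc m - + R)))        ≡⟨ cong (translE τ ∘ support ∘ C) (idx (+ m) (+ R)) ⟩
    translE τ (support (C (+ m - + R + + 1)))      ≡⟨ cong nextE (proj₂ (at-index p)) ⟩
    support (D (proj₁ (at-index p) + + 1))         ∎)
    where
    open ≡-Reasoning
    idx : ∀ m r → + 1 + m - r ≡ m - r + + 1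
    idx = solve-∀
  index : ∀ m (p : m ℕ.< len) → proj₁ (at-index p) ≡ k₀ + + m
  index zero (s≤s z≤n) = sym (ℤₚ.+-identityʳ k₀)
  index (suc m) p = trans (consecutive m (ℕₚ.<⇒≤ p) p) (trans (cong (_+ + 1) (index m (ℕₚ.<⇒≤ p)))
    (trans (ℤₚ.+-assoc k₀ (+ m) (+ 1)) (cong (λ z → k₀ + z) (ℤₚ.+-comm (+ m) (+ 1)))))
  match : ∀ x → ∣ x ∣ ℕ.≤ R → dir (D (x + (k₀ + + R))) ≡ dir (C x)
  match x le =
    let n , e , n≤ = fromCentre x R le
        p = s≤s (ℕₚ.≤-trans n≤ (ℕₚ.+-monoˡ-≤ R le))
    in trans (cong (dir ∘ D) (trans (cong (_+ (k₀ + + R)) e) (trans (idx (+ n) (+ R) k₀) (sym (index n p)))))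
         (trans (cong (dir ∘ dseg) (sym (proj₂ (at-index p)))) (cong (dir ∘ C) (sym e)))
    where
    idx : ∀ n r k → n - r + (k + r) ≡ k + n
    idx = solve-∀

matches-turns : ∀ C D {t R} → (∀ x → ∣ x ∣ ℕ.≤ suc R → dir (D (x + t)) ≡ dir (C x)) →
  ∀ x → ∣ x ∣ ℕ.≤ R → assocSeq D (x + t) ≡ assocSeq C x
matches-turns C D {t} {R} match x le = cong₂ turn (match x (ℕₚ.m≤n⇒m≤1+n le))
  (trans (cong (dir ∘ D) (idx x t)) (match (x + + 1)
    (ℕₚ.≤-trans (ℤₚ.∣i+j∣≤∣i∣+∣j∣ x (+ 1)) (subst (ℕ._≤ suc R) (ℕₚ.+-comm 1 ∣ x ∣) (s≤s le)))))
  where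
  idx : ∀ x t → x + t + + 1 ≡ x + + 1 + t
  idx = solve-∀

word-cong : ∀ a b h h′ m → (∀ j → j ℕ.< m → a (h + + 1 + + j) ≡ b (h′ + + 1 + + j)) → word a h m ≡ word b h′ m
word-cong a b h h′ zero    agree = refl
word-cong a b h h′ (suc m) agree = cong₂ _∷_
  (trans (cong a (sym (ℤₚ.+-identityʳ _))) (trans (agree 0 (s≤s z≤n)) (cong b (ℤₚ.+-identityʳ _))))
  (word-cong a b (h + + 1) (h′ + + 1) m (λ j p → trans (cong a (ℤₚ.+-assoc (h + + 1) (+ 1) (+ j)))
    (trans (agree (suc j) (s≤s p)) (cong b (sym (ℤₚ.+-assoc (h′ + + 1) (+ 1) (+ j)))))))

matches⇒words : ∀ C D → Matches C D → ∀ h m → ∃[ h′ ] (word (assocSeq C) h m ≡ word (assocSeq D) h′ m)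
matches⇒words C D matches h m =
  let R = ∣ h ∣ ℕ.+ suc m
      t , match = matches (suc R)
      bound : ∀ j → j ℕ.< m → ∣ h + + 1 + + j ∣ ℕ.≤ R
      bound j p = ℕₚ.≤-trans (subst (λ z → ∣ z ∣ ℕ.≤ ∣ h ∣ ℕ.+ suc j) (sym (ℤₚ.+-assoc h (+ 1) (+ j))) (ℤₚ.∣i+j∣≤∣i∣+∣j∣ h (+ suc j)))
        (ℕₚ.+-monoʳ-≤ ∣ h ∣ (ℕₚ.m≤n⇒m≤1+n p))
  in h + t , word-cong (assocSeq C) (assocSeq D) h (h + t) m λ j p →
       trans (sym (matches-turns C D match _ (bound j p))) (cong (assocSeq D) (idx h t (+ j)))
  where
  idx : ∀ h t j → h + + 1 + j + t ≡ h + t + + 1 + j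
  idx = solve-∀

orient-opp : ∀ d → orient (opp d) ≡ orient d
orient-opp = ∀-dir refl refl refl refl

orient-E₁ : ∀ w (D : Derivation (turns w)) k i → InE1 (turns w) i → orient (heading w i) ≡ orient (heading w (base D + + 2 * k + + 1))
orient-E₁ w D k i ∈E₁ with E₁-elim D i ∈E₁
... | k′ , refl = trans (cong (orient ∘ heading w) (idx (base D) k k′))
    ([ cong orient , (λ e → trans (cong orient e) (orient-opp _)) ]′ (parallel w (base D + + 2 * k + + 1) (k′ - k)))
  where
  idx : ∀ h k k′ → h + + 2 * k′ + + 1 ≡ h + + 2 * k + + 1 + + 2 * (k′ - k)
  idx = solve-∀

-- An alternating window marks the complement of E₁, so matching turns align the sets E₁.
aligned : ∀ {a b} (A : Derivation a) (B : Derivation b) t →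
  (∀ x → ∣ x ∣ ℕ.≤ ∣ base A ∣ ℕ.+ 6 → b (x + t) ≡ a x) → ∃[ k ] (base A + t ≡ base B + + 2 * k)
aligned {a} {b} A B t agree = alternating₄-base B (base A + t) alt
  where
  idx : ∀ h t i → h + t + i ≡ h + i + t
  idx = solve-∀
  value : ∀ i → i ℕ.≤ 3 → b (base A + t + + 2 * + i) ≡ a (base A + + 2 * + i)
  value i p = trans (cong b (idx (base A) t (+ 2 * + i))) (agree _
    (ℕₚ.≤-trans (ℤₚ.∣i+j∣≤∣i∣+∣j∣ (base A) (+ 2 * + i)) (ℕₚ.+-monoʳ-≤ ∣ base A ∣
      (subst (λ z → ∣ z ∣ ℕ.≤ 6) (+double i) (double-mono-≤ p)))))
  alt : Alternating₄ b (base A + t)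
  alt i p = trans (value (suc i) p) (trans
    (subst (Alternating₄ a) (ℤₚ.+-identityʳ (base A)) (base-alternating₄ A (+ 0)) i p) (cong neg (sym (value i (ℕₚ.<⇒≤ p)))))

matches⇒sameType : ∀ 𝒞 𝒟 i j → Matches (curve 𝒞 i) (curve 𝒟 j) → SameType (curve 𝒞 i) (curve 𝒟 j)
matches⇒sameType 𝒞 𝒟 i j matches = choose (orient (dir (C (base A + + 1)))) refl
  where
  C = curve 𝒞 i
  D = curve 𝒟 j
  A = derivation (folding 𝒞 i)
  B = derivation (folding 𝒟 j)
  -- The four marking places run from `base A` to `base A + 6`.
  R = ∣ base A ∣ ℕ.+ 6
  t = proj₁ (matches (suc R))
  match = proj₂ (matches (suc R))
  alignment = aligned A B t (matches-turns C D match)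
  typeC : ∀ x → InE1 (assocSeq C) x → orient (dir (C x)) ≡ orient (dir (C (base A + + 1)))
  typeC x ∈E₁ = trans (orient-E₁ (walk 𝒞 i) A (+ 0) x ∈E₁) (cong (λ z → orient (dir (C (z + + 1)))) (ℤₚ.+-identityʳ (base A)))
  idx : ∀ h t → h + t + + 1 ≡ h + + 1 + t
  idx = solve-∀
  typeD : ∀ x → InE1 (assocSeq D) x → orient (dir (D x)) ≡ orient (dir (C (base A + + 1)))
  typeD x ∈E₁ = trans (orient-E₁ (walk 𝒟 j) B (proj₁ alignment) x ∈E₁)
    (trans (cong (λ z → orient (dir (D (z + + 1)))) (sym (proj₂ alignment)))
    (trans (cong (orient ∘ dir ∘ D) (idx (base A) t)) (cong orient (match (base A + + 1)
      (ℕₚ.≤-trans (ℤₚ.∣i+j∣≤∣i∣+∣j∣ (base A) (+ 1)) (ℕₚ.≤-trans (ℕₚ.+-monoʳ-≤ ∣ base A ∣ (s≤s z≤n)) (ℕₚ.n≤1+n R)))))))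
  choose : ∀ o → orient (dir (C (base A + + 1))) ≡ o → SameType C D
  choose hor e = inj₁ ((λ x p → trans (typeC x p) e) , (λ x p → trans (typeD x p) e))
  choose ver e = inj₂ ((λ x p → trans (typeC x p) e) , (λ x p → trans (typeD x p) e))

words⇒turns : ∀ {a b} → (∀ h m → ∃[ h′ ] (word a h m ≡ word b h′ m)) → ∀ R → ∃[ t ] (∀ x → ∣ x ∣ ℕ.≤ R → b (x + t) ≡ a x)
words⇒turns {a} {b} words R =
  let h = - (+ R) - + 1
      m = suc (R ℕ.+ R)
      h′ , e = words h m
  in h′ + + 1 + + R , λ x le →
    let n , e′ , n≤ = fromCentre x R le
        p = s≤s (ℕₚ.≤-trans n≤ (ℕₚ.+-monoˡ-≤ R le))
    in trans (cong b (trans (cong (_+ (h′ + + 1 + + R)) e′) (idx (+ n) (+ R) h′)))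
         (trans (sym (at-word b h′ m p)) (trans (cong (λ w → at w n) (sym e))
         (trans (at-word a h m p) (cong a (trans (idx′ (+ n) (+ R)) (sym e′))))))
  where
  idx : ∀ n r h → n - r + (h + + 1 + r) ≡ h + + 1 + n
  idx = solve-∀
  idx′ : ∀ n r → - r - + 1 + + 1 + n ≡ n - r
  idx′ = solve-∀

same-orient : ∀ d e → orient d ≡ orient e → d ≡ e ⊎ d ≡ opp e
same-orient E E _ = inj₁ refl
same-orient E W _ = inj₂ refl
same-orient W E _ = inj₂ refl
same-orient W W _ = inj₁ refl
same-orient N N _ = inj₁ refl
same-orient N S _ = inj₂ refl
same-orient S N _ = inj₂ refl
same-orient S S _ = inj₁ refl

rot-injective : ∀ s d e → rot s d ≡ rot s e → d ≡ e
rot-injective s d e p = trans (sym (rot-neg s d)) (trans (cong (rot (neg s)) p) (rot-neg s e))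

turns⇒headings : ∀ w w′ t R (g : Dir → Dir) → (∀ s d → rot s (g d) ≡ g (rot s d)) →
  (∀ x → ∣ x ∣ ℕ.≤ R → turns w′ (x + t) ≡ turns w x) →
  ∀ y → ∣ y ∣ ℕ.≤ R → heading w′ (y + t) ≡ g (heading w y) → ∀ x → ∣ x ∣ ℕ.≤ R → heading w′ (x + t) ≡ g (heading w x)
turns⇒headings w w′ t R g g-rot agree y y≤ e x x≤ = spread-from-0 P R up down (spread-to-0 P R up down y y≤ e) x x≤
  where
  P : ℤ → Set
  P x = heading w′ (x + t) ≡ g (heading w x)
  idx : ∀ x t → x + + 1 + t ≡ x + t + + 1
  idx = solve-∀
  left : ∀ x → heading w′ (x + + 1 + t) ≡ rot (turns w′ (x + t)) (heading w′ (x + t))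
  left x = trans (cong (heading w′) (idx x t)) (rotate w′ (x + t))
  right : ∀ x → g (heading w (x + + 1)) ≡ rot (turns w x) (g (heading w x))
  right x = trans (cong g (rotate w x)) (sym (g-rot (turns w x) (heading w x)))
  up : ∀ x → ∣ x ∣ ℕ.≤ R → P x → P (x + + 1)
  up x le p = trans (left x) (trans (cong₂ rot (agree x le) p) (sym (right x)))
  down : ∀ x → ∣ x ∣ ℕ.≤ R → P (x + + 1) → P x
  down x le p = rot-injective (turns w x) _ _
    (trans (cong (λ s → rot s (heading w′ (x + t))) (sym (agree x le))) (trans (sym (left x)) (trans p (right x))))

-- Matching turns align the sets E₁, where equal type makes the headings parallel. If they are
-- opposite, the stretch is replaced by its reversed recurrence at distance `u`, and the two half
-- turns cancel.
sameType⇒matches : ∀ 𝒞 𝒟 i j → SameType (curve 𝒞 i) (curve 𝒟 j) →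
  (∀ h m → ∃[ h′ ] (word (assocSeq (curve 𝒞 i)) h m ≡ word (assocSeq (curve 𝒟 j)) h′ m)) → Matches (curve 𝒞 i) (curve 𝒟 j)
sameType⇒matches 𝒞 𝒟 i j sameType words R = choose (same-orient _ _ oriented)
  where
  w  = walk 𝒞 i
  w′ = walk 𝒟 j
  A = derivation (folding 𝒞 i)
  B = derivation (folding 𝒟 j)
  u = proj₁ (reversal w R)
  turned = proj₂ (reversal w R)
  -- Large enough for the shifted stretch `x + u` and for the marking places of E₁.
  R′ = R ℕ.+ ∣ u ∣ ℕ.+ (∣ base A ∣ ℕ.+ 6)
  t = proj₁ (words⇒turns words R′)
  agree = proj₂ (words⇒turns words R′)
  base≤ : ∣ base A ∣ ℕ.+ 6 ℕ.≤ R′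
  base≤ = ℕₚ.m≤n+m (∣ base A ∣ ℕ.+ 6) (R ℕ.+ ∣ u ∣)
  y = base A + + 1
  y≤ : ∣ y ∣ ℕ.≤ R′
  y≤ = ℕₚ.≤-trans (ℤₚ.∣i+j∣≤∣i∣+∣j∣ (base A) (+ 1)) (ℕₚ.≤-trans (ℕₚ.+-monoʳ-≤ ∣ base A ∣ (s≤s z≤n)) base≤)
  y∈E₁ : InE1 (turns w) y
  y∈E₁ = subst (λ z → InE1 (turns w) (z + + 1)) (ℤₚ.+-identityʳ (base A)) (E₁-intro A (+ 0))
  idx : ∀ h t → h + t + + 1 ≡ h + + 1 + t
  idx = solve-∀
  y+t∈E₁ : InE1 (turns w′) (y + t)
  y+t∈E₁ = let k , e = aligned A B t (λ x le → agree x (ℕₚ.≤-trans le base≤))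
           in subst (InE1 (turns w′)) (trans (cong (_+ + 1) (sym e)) (idx (base A) t)) (E₁-intro B k)
  oriented : orient (heading w′ (y + t)) ≡ orient (heading w y)
  oriented = [ (λ p → trans (proj₂ p _ y+t∈E₁) (sym (proj₁ p _ y∈E₁)))
             , (λ p → trans (proj₂ p _ y+t∈E₁) (sym (proj₁ p _ y∈E₁))) ]′ sameType
  R≤ : R ℕ.≤ R′
  R≤ = ℕₚ.≤-trans (ℕₚ.m≤m+n R ∣ u ∣) (ℕₚ.m≤m+n _ (∣ base A ∣ ℕ.+ 6))
  choose : heading w′ (y + t) ≡ heading w y ⊎ heading w′ (y + t) ≡ opp (heading w y) →
    ∃[ t ] (∀ x → ∣ x ∣ ℕ.≤ R → heading w′ (x + t) ≡ heading w x)
  choose (inj₁ e) = t , λ x le → turns⇒headings w w′ t R′ (λ d → d) (λ _ _ → refl) agree y y≤ e x (ℕₚ.≤-trans le R≤)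
  choose (inj₂ e) = u + t , λ x le →
    trans (cong (heading w′) (sym (ℤₚ.+-assoc x u t)))
      (trans (turns⇒headings w w′ t R′ opp rot-opp agree y y≤ e (x + u)
        (ℕₚ.≤-trans (ℤₚ.∣i+j∣≤∣i∣+∣j∣ x u) (ℕₚ.≤-trans (ℕₚ.+-monoˡ-≤ ∣ u ∣ le) (ℕₚ.m≤m+n _ (∣ base A ∣ ℕ.+ 6)))))
      (trans (cong opp (turned x le)) (opp-involutive _)))

matches⇒translates : ∀ 𝒞 𝒟 i j → Matches (curve 𝒞 i) (curve 𝒟 j) → ∀ R →
  ∃[ τ ] ∃[ t ] (∀ x → ∣ x ∣ ℕ.≤ R → translS τ (curve 𝒞 i x) ≡ curve 𝒟 j (x + t))
matches⇒translates 𝒞 𝒟 i j matches R = τ , t , λ x le →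
    seg-cong (spread-from-0 P R up down base₀ x le) (sym (match x le))
  where
  w  = walk 𝒞 i
  w′ = walk 𝒟 j
  t = proj₁ (matches R)
  match = proj₂ (matches R)
  τ = pos w′ (+ 0 + t) ⊕ (⊖ pos w (+ 0))
  P : ℤ → Set
  P x = τ ⊕ pos w x ≡ pos w′ (x + t)
  seg-cong : ∀ {s : Segment} {p d} → p ≡ start s → d ≡ dir s → seg p d ≡ s
  seg-cong refl refl = refl
  base₀ : P (+ 0)
  base₀ = trans (⊕-assoc (pos w′ (+ 0 + t)) _ _) (trans (cong (pos w′ (+ 0 + t) ⊕_)
    (trans (⊕-comm _ (pos w (+ 0))) (⊕-inverseʳ (pos w (+ 0))))) (⊕-identityʳ _))
  idx : ∀ x t → x + + 1 + t ≡ x + t + + 1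
  idx = solve-∀
  left : ∀ x → τ ⊕ pos w (x + + 1) ≡ (τ ⊕ pos w x) ⊕ step (heading w x)
  left x = trans (cong (τ ⊕_) (advance w x)) (sym (⊕-assoc τ (pos w x) _))
  right : ∀ x → ∣ x ∣ ℕ.≤ R → pos w′ (x + + 1 + t) ≡ pos w′ (x + t) ⊕ step (heading w x)
  right x le = trans (cong (pos w′) (idx x t)) (trans (advance w′ (x + t)) (cong (λ d → pos w′ (x + t) ⊕ step d) (match x le)))
  up : ∀ x → ∣ x ∣ ℕ.≤ R → P x → P (x + + 1)
  up x le p = trans (left x) (trans (cong (_⊕ step (heading w x)) p) (sym (right x le)))
  down : ∀ x → ∣ x ∣ ℕ.≤ R → P (x + + 1) → P x
  down x le p = ⊕-cancelʳ _ _ (step (heading w x)) (trans (sym (left x)) (trans p (right x le)))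

matches⇒locIso : ∀ 𝒞 𝒟 i j → LocalIsoProperty 𝒞 → Matches (curve 𝒞 i) (curve 𝒟 j) → LocIsoInto 𝒞 𝒟
matches⇒locIso 𝒞 𝒟 i j lip matches F decos = τ ⊕ v , All.map place bounded
  where
  C = curve 𝒞 i
  D = curve 𝒟 j
  v = proj₁ (occurs-in-curve 𝒞 lip i F decos)
  Within : ℕ → Deco → Set
  -- The strict bound keeps the neighbours `k - 1` and `k + 1`, which the decoration needs, inside
  -- the matched stretch.
  Within R d = ∃[ k ] (suc ∣ k ∣ ℕ.≤ R × transl v d ≡ decoAt C k)
  bound : ∀ {F} → All (λ d → ∃[ k ] (transl v d ≡ decoAt C k)) F → ∃[ R ] All (Within R) F
  bound [] = 0 , []
  bound ((k , e) ∷ all) =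
    let R , rest = bound all
    in suc ∣ k ∣ ℕ.+ R , (k , ℕₚ.m≤m+n _ R , e) ∷
       All.map (λ (k′ , le , e′) → k′ , ℕₚ.≤-trans le (ℕₚ.m≤n+m R (suc ∣ k ∣)) , e′) rest
  R = proj₁ (bound (proj₂ (occurs-in-curve 𝒞 lip i F decos)))
  bounded = proj₂ (bound (proj₂ (occurs-in-curve 𝒞 lip i F decos)))
  shifted = matches⇒translates 𝒞 𝒟 i j matches R
  τ = proj₁ shifted
  t = proj₁ (proj₂ shifted)
  shift = proj₂ (proj₂ shifted)
  support-shift : ∀ x y → y ≡ x + t → ∣ x ∣ ℕ.≤ R → translE τ (support (C x)) ≡ support (D y)
  support-shift x y refl le = trans (sym (support-transl τ (C x))) (cong support (shift x le))
  deco-cong : ∀ {a a′ s s′ b b′} → a ≡ a′ → s ≡ s′ → b ≡ b′ → deco a s b ≡ deco a′ s′ b′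
  deco-cong refl refl refl = refl
  step≤ : ∀ k e → ∣ e ∣ ≡ 1 → suc ∣ k ∣ ℕ.≤ R → ∣ k + e ∣ ℕ.≤ R
  step≤ k e e≡ le = ℕₚ.≤-trans (ℤₚ.∣i+j∣≤∣i∣+∣j∣ k e)
    (subst (ℕ._≤ R) (trans (ℕₚ.+-comm 1 ∣ k ∣) (cong (∣ k ∣ ℕ.+_) (sym e≡))) le)
  idx : ∀ k t e → k + t + e ≡ k + e + t
  idx = solve-∀
  place : ∀ {d} → Within R d → IsDecoOf 𝒟 (transl (τ ⊕ v) d)
  place {d} (k , le , e) = j , k + t , trans (sym (transl-⊕ τ v d)) (trans (cong (transl τ) e) (deco-cong
    (support-shift (k - + 1) (k + t - + 1) (idx k t (- (+ 1))) (step≤ k (- (+ 1)) refl le))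
    (shift k (ℕₚ.<⇒≤ le))
    (support-shift (k + + 1) (k + t + + 1) (idx k t (+ 1)) (step≤ k (+ 1) refl le))))

theorem3p2 : (𝒞 𝒟 : Covering) → LocalIsoProperty 𝒞 → LocalIsoProperty 𝒟 →
    LocIsoCov 𝒞 𝒟 ⇔ (∀ (i : Index 𝒞) (j : Index 𝒟) →
    SameType (curve 𝒞 i) (curve 𝒟 j) × LocIsoSeq (assocSeq (curve 𝒞 i)) (assocSeq (curve 𝒟 j)))
theorem3p2 𝒞 𝒟 lip𝒞 lip𝒟 = mk⇔ forward backward
  where
  forward : LocIsoCov 𝒞 𝒟 → ∀ i j →
    SameType (curve 𝒞 i) (curve 𝒟 j) × LocIsoSeq (assocSeq (curve 𝒞 i)) (assocSeq (curve 𝒟 j))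
  forward (𝒞→𝒟 , 𝒟→𝒞) i j =
    let there = locIso⇒matches 𝒞 𝒟 𝒞→𝒟 lip𝒟 i j
        back  = locIso⇒matches 𝒟 𝒞 𝒟→𝒞 lip𝒞 j i
    in matches⇒sameType 𝒞 𝒟 i j there , matches⇒words (curve 𝒞 i) (curve 𝒟 j) there , matches⇒words (curve 𝒟 j) (curve 𝒞 i) back
  -- One curve from each covering suffices, and a covering is nonempty because it covers the edge at
  -- the origin.
  someIndex : (ℬ : Covering) → Index ℬ
  someIndex ℬ = proj₁ (covers ℬ (edge (+ 0 , + 0) hor))
  swap-type : ∀ C D → SameType C D → SameType D C
  swap-type C D (inj₁ (c , d)) = inj₁ (d , c)
  swap-type C D (inj₂ (c , d)) = inj₂ (d , c)
  backward : (∀ i j → SameType (curve 𝒞 i) (curve 𝒟 j) × LocIsoSeq (assocSeq (curve 𝒞 i)) (assocSeq (curve 𝒟 j))) →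
    LocIsoCov 𝒞 𝒟
  backward same =
    let i = someIndex 𝒞
        j = someIndex 𝒟
        sameType , 𝒞→𝒟 , 𝒟→𝒞 = same i j
    in matches⇒locIso 𝒞 𝒟 i j lip𝒞 (sameType⇒matches 𝒞 𝒟 i j sameType 𝒞→𝒟)
     , matches⇒locIso 𝒟 𝒞 j i lip𝒟 (sameType⇒matches 𝒟 𝒞 j i (swap-type (curve 𝒞 i) (curve 𝒟 j) sameType) 𝒟→𝒞)
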